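{- For $p,q\in\mathbb Z_{\ge2}$, \begin{align*} &(1+(-1)^p)\zeta_2^\sharp(p,q)+(1+(-1)^q)\zeta_2^\sharp(q,p)\\ &=2\sum_{j=0}^{[p/2]}\frac{1}{2^{p+q-2j}}\binom{p+q-1-2j}{q-1}\zeta(2j)\zeta(p+q-2j)+2\sum_{j=0}^{[q/2]}\frac{1}{2^{p+q-2j}}\binom{p+q-1-2j}{p-1}\zeta(2j)\zeta(p+q-2j)-\zeta(p+q). \end{align*}
   Context: $\zeta_2^\sharp(s_1,s_2)=\sum_{m,n=1}^\infty n^{ -s_1}(2m+n)^{ -s_2}$; $\zeta$ is the Riemann zeta-function (so $\zeta(0)=-1/2$); $[x]$ is the integer part of $x$. -}

module Defs where

open import Algebra.Bundles.Raw using (RawMonoid)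
import Algebra.Definitions.RawMonoid as RawSum
open import Data.Fin.Base using (toℕ)
open import Data.Integer.Base as ℤ using (ℤ; +_)
import Data.Integer.Properties as ℤ
import Data.Integer.Solver as ℤSolver
open import Data.Nat.Base as ℕ using (ℕ; zero; suc; z≤n; s≤s)
import Data.Nat.Properties as ℕ
open import Data.Product.Base using (∃; _×_; _,_; proj₁; proj₂)
open import Data.Rational.Base
open import Data.Rational.Properties
import Data.Rational.Solver as ℚSolver
import Data.Rational.Unnormalised.Base as ℚᵘ
import Data.Rational.Unnormalised.Properties as ℚᵘ
open import Data.Sum.Base using (inj₁; inj₂)
open import Level using (0ℓ)
open import Relation.Binary.PropositionalEquality

-- Real numbers: Cauchy sequences of rationals, with equality _≈ᴿ_.

IsCauchy : (ℕ → ℚ) → Set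
IsCauchy u = ∀ ε → 0ℚ < ε →
  ∃ λ N → ∀ m n → N ℕ.≤ m → N ℕ.≤ n → ∣ u m - u n ∣ < ε

record ℝ : Set where
  constructor mkℝ
  field
    seq    : ℕ → ℚ
    cauchy : IsCauchy seq

open ℝ public

infix 4 _≈ᴿ_

_≈ᴿ_ : ℝ → ℝ → Set
x ≈ᴿ y = ∀ ε → 0ℚ < ε → ∃ λ N → ∀ n → N ℕ.≤ n → ∣ seq x n - seq y n ∣ < ε

module CauchyLemmas where
  module ℚS = ℚSolver.+-*-Solver
  module ℤS = ℤSolver.+-*-Solver

  x-x≡0 : ∀ x → x - x ≡ 0ℚ
  x-x≡0 = +-inverseʳ

  ∣x-y∣≡∣y-x∣ : ∀ x y → ∣ x - y ∣ ≡ ∣ y - x ∣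
  ∣x-y∣≡∣y-x∣ x y = trans (cong ∣_∣ (lem x y)) (∣-p∣≡∣p∣ (y - x))
    where
    lem : ∀ a b → a - b ≡ - (b - a)
    lem = ℚS.solve 2 (λ a b → a ℚS.:- b ℚS.:= ℚS.:- (b ℚS.:- a)) refl

  0≤y-x : ∀ {x y} → x ≤ y → 0ℚ ≤ y - x
  0≤y-x {x} {y} x≤y = subst (_≤ y - x) (x-x≡0 x) (+-monoˡ-≤ (- x) x≤y)

  half : ∀ ε → ½ * ε + ½ * ε ≡ ε
  half = ℚS.solve 1 (λ e → ℚS.con ½ ℚS.:* e ℚS.:+ ℚS.con ½ ℚS.:* e ℚS.:= e) refl

  *-pos : ∀ {x y} → 0ℚ < x → 0ℚ < y → 0ℚ < x * y
  *-pos {x} {y} 0<x 0<y =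
    positive⁻¹ (x * y) {{pos*pos⇒pos x {{positive 0<x}} y {{positive 0<y}}}}

  *-mono-≤-nonNeg : ∀ {a b c d} → 0ℚ ≤ c → 0ℚ ≤ b → a ≤ b → c ≤ d → a * c ≤ b * d
  *-mono-≤-nonNeg {a} {b} {c} {d} 0≤c 0≤b a≤b c≤d = ≤-trans
    (*-monoʳ-≤-nonNeg c {{nonNegative 0≤c}} a≤b)
    (*-monoˡ-≤-nonNeg b {{nonNegative 0≤b}} c≤d)

  const-cauchy : ∀ x → IsCauchy (λ _ → x)
  const-cauchy x ε 0<ε = 0 , λ _ _ _ _ → subst (λ z → ∣ z ∣ < ε) (sym (x-x≡0 x)) 0<ε

  neg-cauchy : ∀ u → IsCauchy u → IsCauchy (λ n → - u n)
  neg-cauchy u cu ε 0<ε with cu ε 0<ε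
  ... | N , h = N , λ m n N≤m N≤n →
    subst (_< ε) (sym (trans (cong ∣_∣ (lem (u m) (u n))) (∣-p∣≡∣p∣ (u m - u n)))) (h m n N≤m N≤n)
    where
    lem : ∀ a b → - a - - b ≡ - (a - b)
    lem = ℚS.solve 2 (λ a b → ℚS.:- a ℚS.:- ℚS.:- b ℚS.:= ℚS.:- (a ℚS.:- b)) refl

  +-cauchy : ∀ u v → IsCauchy u → IsCauchy v → IsCauchy (λ n → u n + v n)
  +-cauchy u v cu cv ε 0<ε
    with cu (½ * ε) (*-pos {½} (positive⁻¹ ½) 0<ε) | cv (½ * ε) (*-pos {½} (positive⁻¹ ½) 0<ε)
  ... | N₁ , h₁ | N₂ , h₂ = N₁ ℕ.⊔ N₂ , λ m n N≤m N≤n → begin-strict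
    ∣ (u m + v m) - (u n + v n) ∣  ≡⟨ cong ∣_∣ (lem (u m) (v m) (u n) (v n)) ⟩
    ∣ (u m - u n) + (v m - v n) ∣  ≤⟨ ∣p+q∣≤∣p∣+∣q∣ (u m - u n) (v m - v n) ⟩
    ∣ u m - u n ∣ + ∣ v m - v n ∣
      <⟨ +-mono-< (h₁ m n (ℕ.m⊔n≤o⇒m≤o N₁ N₂ N≤m) (ℕ.m⊔n≤o⇒m≤o N₁ N₂ N≤n))
                  (h₂ m n (ℕ.m⊔n≤o⇒n≤o N₁ N₂ N≤m) (ℕ.m⊔n≤o⇒n≤o N₁ N₂ N≤n)) ⟩
    ½ * ε + ½ * ε                  ≡⟨ half ε ⟩
    ε                              ∎
    where
    open ≤-Reasoning
    lem : ∀ a b c d → (a + b) - (c + d) ≡ (a - c) + (b - d)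
    lem = ℚS.solve 4 (λ a b c d →
      (a ℚS.:+ b) ℚS.:- (c ℚS.:+ d) ℚS.:= (a ℚS.:- c) ℚS.:+ (b ℚS.:- d)) refl

  eventually-bounded : ∀ {u} → IsCauchy u →
    ∃ λ B → 0ℚ < B × (∃ λ N → ∀ n → N ℕ.≤ n → ∣ u n ∣ ≤ B)
  eventually-bounded {u} cu with cu 1ℚ (positive⁻¹ 1ℚ)
  ... | N , h = 1ℚ + ∣ u N ∣
              , +-mono-<-≤ (positive⁻¹ 1ℚ) (0≤∣p∣ (u N))
              , N , λ n N≤n → begin
    ∣ u n ∣                 ≡⟨ cong ∣_∣ (lem (u n) (u N)) ⟩
    ∣ (u n - u N) + u N ∣   ≤⟨ ∣p+q∣≤∣p∣+∣q∣ (u n - u N) (u N) ⟩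
    ∣ u n - u N ∣ + ∣ u N ∣ ≤⟨ +-monoˡ-≤ ∣ u N ∣ (<⇒≤ (h n N N≤n ℕ.≤-refl)) ⟩
    1ℚ + ∣ u N ∣            ∎
    where
    open ≤-Reasoning
    lem : ∀ a b → a ≡ (a - b) + b
    lem = ℚS.solve 2 (λ a b → a ℚS.:= (a ℚS.:- b) ℚS.:+ b) refl

  scale : ∀ c ε → 0ℚ < c → 0ℚ < ε → ∃ λ δ → 0ℚ < δ × c * δ ≡ ε
  scale c ε 0<c 0<ε = 1/ c * ε , *-pos {1/ c} {ε} (positive⁻¹ (1/ c) {{1/pos⇒pos c}}) 0<ε , (begin
    c * (1/ c * ε)  ≡⟨ *-assoc c (1/ c) ε ⟨
    (c * 1/ c) * ε  ≡⟨ cong (_* ε) (*-inverseʳ c) ⟩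
    1ℚ * ε          ≡⟨ *-identityˡ ε ⟩
    ε               ∎)
    where
    open ≡-Reasoning
    instance
      c-pos : Positive c
      c-pos = positive 0<c
      c-nonZero : NonZero c
      c-nonZero = pos⇒nonZero c

  *-close : ∀ a b c d A B δ → 0ℚ < A → 0ℚ < B → ∣ a ∣ ≤ A → ∣ d ∣ ≤ B →
            ∣ a - c ∣ < δ → ∣ b - d ∣ < δ → ∣ a * b - c * d ∣ < (A + B) * δ
  *-close a b c d A B δ 0<A 0<B ∣a∣≤A ∣d∣≤B a-c b-d = begin-strict
    ∣ a * b - c * d ∣                      ≡⟨ cong ∣_∣ (lem a b c d) ⟩
    ∣ a * (b - d) + (a - c) * d ∣          ≤⟨ ∣p+q∣≤∣p∣+∣q∣ (a * (b - d)) ((a - c) * d) ⟩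
    ∣ a * (b - d) ∣ + ∣ (a - c) * d ∣      ≡⟨ cong₂ _+_ (∣p*q∣≡∣p∣*∣q∣ a (b - d)) (∣p*q∣≡∣p∣*∣q∣ (a - c) d) ⟩
    ∣ a ∣ * ∣ b - d ∣ + ∣ a - c ∣ * ∣ d ∣  ≤⟨ +-mono-≤
      (*-monoʳ-≤-nonNeg ∣ b - d ∣ {{∣-∣-nonNeg (b - d)}} ∣a∣≤A)
      (*-monoˡ-≤-nonNeg ∣ a - c ∣ {{∣-∣-nonNeg (a - c)}} ∣d∣≤B) ⟩
    A * ∣ b - d ∣ + ∣ a - c ∣ * B          <⟨ +-mono-<
      (*-monoʳ-<-pos A {{positive 0<A}} b-d)
      (*-monoˡ-<-pos B {{positive 0<B}} a-c) ⟩
    A * δ + δ * B                          ≡⟨ lem′ A B δ ⟩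
    (A + B) * δ                            ∎
    where
    open ≤-Reasoning
    lem : ∀ a b c d → a * b - c * d ≡ a * (b - d) + (a - c) * d
    lem = ℚS.solve 4 (λ a b c d → a ℚS.:* b ℚS.:- c ℚS.:* d
      ℚS.:= a ℚS.:* (b ℚS.:- d) ℚS.:+ (a ℚS.:- c) ℚS.:* d) refl
    lem′ : ∀ a b d → a * d + d * b ≡ (a + b) * d
    lem′ = ℚS.solve 3 (λ a b d → a ℚS.:* d ℚS.:+ d ℚS.:* b ℚS.:= (a ℚS.:+ b) ℚS.:* d) refl

  *-cauchy : ∀ u v → IsCauchy u → IsCauchy v → IsCauchy (λ n → u n * v n)
  *-cauchy u v cu cv ε 0<ε =
    let A , 0<A , M₁ , ∣u∣≤A = eventually-bounded cu
        B , 0<B , M₂ , ∣v∣≤B = eventually-bounded cv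
        δ , 0<δ , [A+B]δ≡ε   = scale (A + B) ε (+-mono-< {0ℚ} {A} {0ℚ} {B} 0<A 0<B) 0<ε
        M₃ , h₁              = cu δ 0<δ
        M₄ , h₂              = cv δ 0<δ
    in (M₁ ℕ.⊔ M₂) ℕ.⊔ (M₃ ℕ.⊔ M₄) , λ m n N≤m N≤n →
      <-≤-trans
        (*-close (u m) (v m) (u n) (v n) A B δ 0<A 0<B
          (∣u∣≤A m (fst M₁ M₂ (fst (M₁ ℕ.⊔ M₂) (M₃ ℕ.⊔ M₄) N≤m)))
          (∣v∣≤B n (snd M₁ M₂ (fst (M₁ ℕ.⊔ M₂) (M₃ ℕ.⊔ M₄) N≤n)))
          (h₁ m n (fst M₃ M₄ (snd (M₁ ℕ.⊔ M₂) (M₃ ℕ.⊔ M₄) N≤m))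
                  (fst M₃ M₄ (snd (M₁ ℕ.⊔ M₂) (M₃ ℕ.⊔ M₄) N≤n)))
          (h₂ m n (snd M₃ M₄ (snd (M₁ ℕ.⊔ M₂) (M₃ ℕ.⊔ M₄) N≤m))
                  (snd M₃ M₄ (snd (M₁ ℕ.⊔ M₂) (M₃ ℕ.⊔ M₄) N≤n))))
        (≤-reflexive [A+B]δ≡ε)
    where
    fst : ∀ i j {k} → i ℕ.⊔ j ℕ.≤ k → i ℕ.≤ k
    fst i j = ℕ.m⊔n≤o⇒m≤o i j
    snd : ∀ i j {k} → i ℕ.⊔ j ℕ.≤ k → j ℕ.≤ k
    snd i j = ℕ.m⊔n≤o⇒n≤o i j

open CauchyLemmas

fromℚ : ℚ → ℝ
fromℚ x = mkℝ (λ _ → x) (const-cauchy x)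

fromℤ : ℤ → ℝ
fromℤ i = fromℚ (i / 1)

fromℕ : ℕ → ℝ
fromℕ n = fromℤ (+ n)

infixl 6 _+ᴿ_ _-ᴿ_
infixl 7 _*ᴿ_
infix  8 -ᴿ_

_+ᴿ_ : ℝ → ℝ → ℝ
x +ᴿ y = mkℝ (λ n → seq x n + seq y n) (+-cauchy (seq x) (seq y) (cauchy x) (cauchy y))

_*ᴿ_ : ℝ → ℝ → ℝ
x *ᴿ y = mkℝ (λ n → seq x n * seq y n) (*-cauchy (seq x) (seq y) (cauchy x) (cauchy y))

-ᴿ_ : ℝ → ℝ
-ᴿ x = mkℝ (λ n → - seq x n) (neg-cauchy (seq x) (cauchy x))

_-ᴿ_ : ℝ → ℝ → ℝ
x -ᴿ y = x +ᴿ -ᴿ y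

ℝ-+-rawMonoid : RawMonoid 0ℓ 0ℓ
ℝ-+-rawMonoid = record { Carrier = ℝ ; _≈_ = _≈ᴿ_ ; _∙_ = _+ᴿ_ ; ε = fromℚ 0ℚ }

-- The rational sum runs over i < n, the real one over j ≤ n.

∑ : ℕ → (ℕ → ℚ) → ℚ
∑ n f = RawSum.sum +-0-rawMonoid {n} (λ i → f (toℕ i))

∑ᴿ : ℕ → (ℕ → ℝ) → ℝ
∑ᴿ n f = RawSum.sum ℝ-+-rawMonoid {suc n} (λ j → f (toℕ j))

infixl 5 ∑ ∑ᴿ
syntax ∑ n (λ i → x) = ∑[ i < n ] x
syntax ∑ᴿ n (λ j → x) = ∑ᴿ[ j ≤ n ] x

-- n ^- s is n⁻ˢ.

infixr 8 _^-_

_^-_ : (n : ℕ) .{{_ : ℕ.NonZero n}} → ℕ → ℚ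
n ^- s = (+ 1 / (n ℕ.^ s)) {{ℕ.m^n≢0 n s}}

module SeriesLemmas where
  ∑-last : ∀ n f → ∑ (suc n) f ≡ ∑ n f + f n
  ∑-last zero    f = trans (+-identityʳ (f 0)) (sym (+-identityˡ (f 0)))
  ∑-last (suc n) f = trans (cong (λ z → f 0 + z) (∑-last n (λ i → f (suc i))))
                           (sym (+-assoc (f 0) (∑ n (λ i → f (suc i))) (f (suc n))))

  ∑-mono : ∀ n {f g} → (∀ i → f i ≤ g i) → ∑ n f ≤ ∑ n g
  ∑-mono zero    f≤g = ≤-refl
  ∑-mono (suc n) f≤g = +-mono-≤ (f≤g 0) (∑-mono n (λ i → f≤g (suc i)))

  ∑-nonNeg : ∀ n {f} → (∀ i → 0ℚ ≤ f i) → 0ℚ ≤ ∑ n f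
  ∑-nonNeg zero    0≤f = ≤-refl
  ∑-nonNeg (suc n) 0≤f = +-mono-≤ (0≤f 0) (∑-nonNeg n (λ i → 0≤f (suc i)))

  ∑-cong : ∀ n {f g} → (∀ i → f i ≡ g i) → ∑ n f ≡ ∑ n g
  ∑-cong zero    f≡g = refl
  ∑-cong (suc n) f≡g = cong₂ _+_ (f≡g 0) (∑-cong n (λ i → f≡g (suc i)))

  ∑-distrib-+ : ∀ n f g → ∑ n (λ i → f i + g i) ≡ ∑ n f + ∑ n g
  ∑-distrib-+ zero    f g = refl
  ∑-distrib-+ (suc n) f g = trans
    (cong (λ z → f 0 + g 0 + z) (∑-distrib-+ n (λ i → f (suc i)) (λ i → g (suc i))))
    (lem (f 0) (g 0) (∑ n (λ i → f (suc i))) (∑ n (λ i → g (suc i))))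
    where
    lem : ∀ a b c d → (a + b) + (c + d) ≡ (a + c) + (b + d)
    lem = ℚS.solve 4 (λ a b c d →
      (a ℚS.:+ b) ℚS.:+ (c ℚS.:+ d) ℚS.:= (a ℚS.:+ c) ℚS.:+ (b ℚS.:+ d)) refl

  ∑-*ˡ : ∀ n c f → ∑ n (λ i → c * f i) ≡ c * ∑ n f
  ∑-*ˡ zero    c f = sym (*-zeroʳ c)
  ∑-*ˡ (suc n) c f = trans (cong (λ z → c * f 0 + z) (∑-*ˡ n c (λ i → f (suc i))))
                           (sym (*-distribˡ-+ c (f 0) (∑ n (λ i → f (suc i)))))

  ∑-*ʳ : ∀ n c f → ∑ n (λ i → f i * c) ≡ ∑ n f * c
  ∑-*ʳ zero    c f = sym (*-zeroˡ c)
  ∑-*ʳ (suc n) c f = trans (cong (λ z → f 0 * c + z) (∑-*ʳ n c (λ i → f (suc i))))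
                           (sym (*-distribʳ-+ c (f 0) (∑ n (λ i → f (suc i)))))

  -- comparison test for sequences with increments 0 ≤ Δu ≤ Δw
  module _ (u w : ℕ → ℚ) (mono : ∀ k → u k ≤ u (suc k))
           (dom : ∀ k → u (suc k) - u k ≤ w (suc k) - w k) where

    private
      gap : ∀ d k → u k ≤ u (d ℕ.+ k) × u (d ℕ.+ k) - u k ≤ w (d ℕ.+ k) - w k
      gap zero    k = ≤-refl , ≤-reflexive (trans (x-x≡0 (u k)) (sym (x-x≡0 (w k))))
      gap (suc d) k with gap d k
      ... | p , q = ≤-trans p (mono (d ℕ.+ k)) , subst₂ _≤_
        (lem (u (suc d ℕ.+ k)) (u (d ℕ.+ k)) (u k))
        (lem (w (suc d ℕ.+ k)) (w (d ℕ.+ k)) (w k))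
        (+-mono-≤ (dom (d ℕ.+ k)) q)
        where
        lem : ∀ a b c → (a - b) + (b - c) ≡ a - c
        lem = ℚS.solve 3 (λ a b c →
          (a ℚS.:- b) ℚS.:+ (b ℚS.:- c) ℚS.:= a ℚS.:- c) refl

      x≤∣x∣ : ∀ x → x ≤ ∣ x ∣
      x≤∣x∣ x with ≤-total 0ℚ x
      ... | inj₁ 0≤x = ≤-reflexive (sym (0≤p⇒∣p∣≡p 0≤x))
      ... | inj₂ x≤0 = ≤-trans x≤0 (0≤∣p∣ x)

      close : ∀ {k m} → k ℕ.≤ m → ∣ u m - u k ∣ ≤ ∣ w m - w k ∣
      close {k} {m} k≤m = subst (λ z → ∣ u z - u k ∣ ≤ ∣ w z - w k ∣) (ℕ.m∸n+n≡m k≤m)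
        (≤-trans (≤-reflexive (0≤p⇒∣p∣≡p (0≤y-x (proj₁ g))))
                 (≤-trans (proj₂ g) (x≤∣x∣ _)))
        where g = gap (m ℕ.∸ k) k

    comparison : IsCauchy w → IsCauchy u
    comparison cw ε 0<ε with cw ε 0<ε
    ... | N , h = N , λ m n N≤m N≤n → go m n N≤m N≤n (ℕ.≤-total n m)
      where
      go : ∀ m n → N ℕ.≤ m → N ℕ.≤ n → _ → ∣ u m - u n ∣ < ε
      go m n N≤m N≤n (inj₁ n≤m) = ≤-<-trans (close n≤m) (h m n N≤m N≤n)
      go m n N≤m N≤n (inj₂ m≤n) = subst (_< ε) (∣x-y∣≡∣y-x∣ (u n) (u m))
        (≤-<-trans (close m≤n) (h n m N≤n N≤m))

  toℚᵘ-/ : ∀ i n .{{_ : ℕ.NonZero n}} → toℚᵘ (i / n) ℚᵘ.≃ (i ℚᵘ./ n)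
  toℚᵘ-/ i (suc n) = toℚᵘ-fromℚᵘ (ℚᵘ.mkℚᵘ i n)

  1/-anti : ∀ m n .{{_ : ℕ.NonZero m}} .{{_ : ℕ.NonZero n}} → m ℕ.≤ n → + 1 / n ≤ + 1 / m
  1/-anti m@(suc _) n@(suc _) m≤n = toℚᵘ-cancel-≤ (begin
    toℚᵘ (+ 1 / n) ≃⟨ toℚᵘ-/ (+ 1) n ⟩
    + 1 ℚᵘ./ n     ≤⟨ ℚᵘ.*≤* (ℤ.*-monoˡ-≤-nonNeg (+ 1) (ℤ.+≤+ m≤n)) ⟩
    + 1 ℚᵘ./ m     ≃⟨ toℚᵘ-/ (+ 1) m ⟨
    toℚᵘ (+ 1 / m) ∎)
    where open ℚᵘ.≤-Reasoning

  0≤^- : ∀ n s .{{_ : ℕ.NonZero n}} → 0ℚ ≤ n ^- s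
  0≤^- n s = nonNegative⁻¹ _ {{normalize-nonNeg 1 (n ℕ.^ s) {{ℕ.m^n≢0 n s}}}}

  r : ℕ → ℚ
  r k = + 1 / suc k

  r-diff : ∀ k → + 1 / (suc k ℕ.* suc (suc k)) ≡ r k - r (suc k)
  r-diff k = toℚᵘ-injective (begin
    toℚᵘ (+ 1 / (suc k ℕ.* suc (suc k)))            ≈⟨ toℚᵘ-/ (+ 1) (suc k ℕ.* suc (suc k)) ⟩
    + 1 ℚᵘ./ (suc k ℕ.* suc (suc k))                ≈⟨ ℚᵘ.*≡* (lem (+ suc k) (+ suc (suc k)) refl) ⟩
    (+ 1 ℚᵘ./ suc k) ℚᵘ.- (+ 1 ℚᵘ./ suc (suc k))
      ≈⟨ ℚᵘ.+-cong (toℚᵘ-/ (+ 1) (suc k)) (ℚᵘ.-‿cong (toℚᵘ-/ (+ 1) (suc (suc k)))) ⟨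
    toℚᵘ (r k) ℚᵘ.- toℚᵘ (r (suc k))
      ≈⟨ ℚᵘ.+-congʳ (toℚᵘ (r k)) (toℚᵘ-homo‿- (r (suc k))) ⟨
    toℚᵘ (r k) ℚᵘ.+ toℚᵘ (- r (suc k))              ≈⟨ toℚᵘ-homo-+ (r k) (- r (suc k)) ⟨
    toℚᵘ (r k - r (suc k))                          ∎)
    where
    open import Relation.Binary.Reasoning.Setoid ℚᵘ.≃-setoid
    lem : ∀ a b → b ≡ + 1 ℤ.+ a →
      + 1 ℤ.* (a ℤ.* b) ≡ (+ 1 ℤ.* b ℤ.+ ℤ.- (+ 1) ℤ.* a) ℤ.* (a ℤ.* b)
    lem a _ refl = ℤS.solve 1 (λ x → let y = ℤS.con (+ 1) ℤS.:+ x in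
      ℤS.con (+ 1) ℤS.:* (x ℤS.:* y)
        ℤS.:= (ℤS.con (+ 1) ℤS.:* y ℤS.:+ ℤS.con (ℤ.- (+ 1)) ℤS.:* x) ℤS.:* (x ℤS.:* y)) refl a

  r-double : ∀ k → + 1 / (suc k ℕ.* suc k) ≤ (r k - r (suc k)) + (r k - r (suc k))
  r-double k = subst (+ 1 / (suc k ℕ.* suc k) ≤_) (cong₂ _+_ (r-diff k) (r-diff k))
    (toℚᵘ-cancel-≤ (begin
      toℚᵘ (+ 1 / a)                       ≃⟨ toℚᵘ-/ (+ 1) a ⟩
      + 1 ℚᵘ./ a                           ≤⟨ ℚᵘ.*≤* (subst₂ ℤ._≤_ eq₁ eq₂ (ℤ.+≤+ ineq)) ⟩
      (+ 1 ℚᵘ./ b) ℚᵘ.+ (+ 1 ℚᵘ./ b)       ≃⟨ ℚᵘ.+-cong (toℚᵘ-/ (+ 1) b) (toℚᵘ-/ (+ 1) b) ⟨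
      toℚᵘ (+ 1 / b) ℚᵘ.+ toℚᵘ (+ 1 / b)   ≃⟨ toℚᵘ-homo-+ (+ 1 / b) (+ 1 / b) ⟨
      toℚᵘ (+ 1 / b + + 1 / b)             ∎))
    where
    open ℚᵘ.≤-Reasoning
    a b : ℕ
    a = suc k ℕ.* suc k
    b = suc k ℕ.* suc (suc k)
    ineq₀ : b ℕ.≤ 2 ℕ.* a
    ineq₀ = subst (b ℕ.≤_) (trans (sym (ℕ.*-assoc (suc k) 2 (suc k)))
              (trans (cong (ℕ._* suc k) (ℕ.*-comm (suc k) 2)) (ℕ.*-assoc 2 (suc k) (suc k))))
              (ℕ.*-monoʳ-≤ (suc k) (s≤s (subst (suc k ℕ.≤_) (ℕ.+-comm (suc (k ℕ.+ 0)) k)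
                (s≤s (ℕ.≤-trans (ℕ.m≤m+n k 0) (ℕ.m≤m+n (k ℕ.+ 0) k))))))
    ineq : b ℕ.* b ℕ.≤ (2 ℕ.* a) ℕ.* b
    ineq = ℕ.*-monoˡ-≤ b ineq₀
    eq₁ : + (b ℕ.* b) ≡ + 1 ℤ.* + (b ℕ.* b)
    eq₁ = sym (ℤ.*-identityˡ (+ (b ℕ.* b)))
    eq₂ : + ((2 ℕ.* a) ℕ.* b) ≡ (+ 1 ℤ.* + b ℤ.+ + 1 ℤ.* + b) ℤ.* + a
    eq₂ = trans (ℤ.pos-* (2 ℕ.* a) b) (trans (cong (ℤ._* + b) (ℤ.pos-* 2 a)) (lem (+ a) (+ b)))
      where
      lem : ∀ x y → (+ 2 ℤ.* x) ℤ.* y ≡ (+ 1 ℤ.* y ℤ.+ + 1 ℤ.* y) ℤ.* x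
      lem = ℤS.solve 2 (λ x y → (ℤS.con (+ 2) ℤS.:* x) ℤS.:* y
        ℤS.:= (ℤS.con (+ 1) ℤS.:* y ℤS.:+ ℤS.con (+ 1) ℤS.:* y) ℤS.:* x) refl

  r-archimedean : ∀ ε → 0ℚ < ε → ∃ λ N → r N < ε
  r-archimedean ε@(mkℚ num d _) 0<ε = suc d , toℚᵘ-cancel-< (begin-strict
    toℚᵘ (r (suc d))      ≃⟨ toℚᵘ-/ (+ 1) (suc (suc d)) ⟩
    + 1 ℚᵘ./ suc (suc d)  <⟨ ℚᵘ.*<* (ℤ.*-monoˡ-<-pos (+ 1) (ℤ.+<+ ℕ.≤-refl)) ⟩
    + 1 ℚᵘ./ suc d        ≤⟨ ℚᵘ.*≤* (ℤ.*-monoʳ-≤-nonNeg (+ suc d) 1≤num) ⟩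
    toℚᵘ ε                ∎)
    where
    open ℚᵘ.≤-Reasoning
    1≤num : + 1 ℤ.≤ num
    1≤num = ℤ.i<j⇒suc[i]≤j (ℤ.positive⁻¹ num {{positive 0<ε}})

  r-cauchy : IsCauchy r
  r-cauchy ε 0<ε with r-archimedean ε 0<ε
  ... | N , rN<ε = N , λ m n N≤m N≤n → go m n N≤m N≤n (ℕ.≤-total m n)
    where
    0≤r : ∀ k → 0ℚ ≤ r k
    0≤r k = nonNegative⁻¹ _ {{normalize-nonNeg 1 (suc k)}}
    close : ∀ m n → N ℕ.≤ m → m ℕ.≤ n → ∣ r m - r n ∣ < ε
    close m n N≤m m≤n = begin-strict
      ∣ r m - r n ∣ ≡⟨ 0≤p⇒∣p∣≡p (0≤y-x (1/-anti (suc m) (suc n) (s≤s m≤n))) ⟩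
      r m - r n     ≤⟨ +-monoʳ-≤ (r m) (neg-antimono-≤ (0≤r n)) ⟩
      r m + 0ℚ      ≡⟨ +-identityʳ (r m) ⟩
      r m           ≤⟨ 1/-anti (suc N) (suc m) (s≤s N≤m) ⟩
      r N           <⟨ rN<ε ⟩
      ε             ∎
      where open ≤-Reasoning
    go : ∀ m n → N ℕ.≤ m → N ℕ.≤ n → _ → ∣ r m - r n ∣ < ε
    go m n N≤m N≤n (inj₁ m≤n) = close m n N≤m m≤n
    go m n N≤m N≤n (inj₂ n≤m) = subst (_< ε) (∣x-y∣≡∣y-x∣ (r n) (r m)) (close n m N≤n n≤m)

  ∑-increment : ∀ f k → ∑ (suc k) f - ∑ k f ≡ f k
  ∑-increment f k = trans (cong (_- ∑ k f) (∑-last k f)) (lem (∑ k f) (f k))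
    where
    lem : ∀ a b → (a + b) - a ≡ b
    lem = ℚS.solve 2 (λ a b → (a ℚS.:+ b) ℚS.:- a ℚS.:= b) refl

  x≤x+y : ∀ x {y} → 0ℚ ≤ y → x ≤ x + y
  x≤x+y x {y} 0≤y = subst (_≤ x + y) (+-identityʳ x) (+-monoʳ-≤ x 0≤y)

  inverse-power-sum-cauchy : ∀ s → 2 ℕ.≤ s → IsCauchy (λ N → ∑[ i < N ] suc i ^- s)
  inverse-power-sum-cauchy s 2≤s = comparison u (λ n → - r n + - r n) mono dom
    (+-cauchy (λ n → - r n) (λ n → - r n) (neg-cauchy r r-cauchy) (neg-cauchy r r-cauchy))
    where
    f : ℕ → ℚ
    f i = suc i ^- s
    u : ℕ → ℚ
    u N = ∑ N f
    mono : ∀ k → u k ≤ u (suc k)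
    mono k = subst (u k ≤_) (sym (∑-last k f)) (x≤x+y (u k) (0≤^- (suc k) s))
    square≤ : ∀ k → suc k ℕ.* suc k ℕ.≤ suc k ℕ.^ s
    square≤ k = subst (ℕ._≤ suc k ℕ.^ s) (cong (suc k ℕ.*_) (ℕ.*-identityʳ (suc k)))
                  (ℕ.^-monoʳ-≤ (suc k) 2≤s)
    lem : ∀ a b → (a - b) + (a - b) ≡ (- b + - b) - (- a + - a)
    lem = ℚS.solve 2 (λ a b → (a ℚS.:- b) ℚS.:+ (a ℚS.:- b)
      ℚS.:= (ℚS.:- b ℚS.:+ ℚS.:- b) ℚS.:- (ℚS.:- a ℚS.:+ ℚS.:- a)) refl
    dom : ∀ k → u (suc k) - u k ≤ (- r (suc k) + - r (suc k)) - (- r k + - r k)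
    dom k = begin
      u (suc k) - u k                          ≡⟨ ∑-increment f k ⟩
      suc k ^- s                               ≤⟨ 1/-anti (suc k ℕ.* suc k) (suc k ℕ.^ s)
                                                    {{_}} {{ℕ.m^n≢0 (suc k) s}} (square≤ k) ⟩
      + 1 / (suc k ℕ.* suc k)                  ≤⟨ r-double k ⟩
      (r k - r (suc k)) + (r k - r (suc k))    ≡⟨ lem (r k) (r (suc k)) ⟩
      (- r (suc k) + - r (suc k)) - (- r k + - r k) ∎
      where open ≤-Reasoning

  square-sum : (ℕ → ℕ → ℚ) → ℕ → ℚ
  square-sum f N = ∑[ i < N ] ∑[ j < N ] f i j

  boundary : (ℕ → ℕ → ℚ) → ℕ → ℚ
  boundary f k = ∑ k (λ i → f i k) + ∑ (suc k) (f k)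

  square-sum-step : ∀ f k → square-sum f (suc k) ≡ square-sum f k + boundary f k
  square-sum-step f k = begin
    square-sum f (suc k)
      ≡⟨ ∑-last k (λ i → ∑ (suc k) (f i)) ⟩
    ∑ k (λ i → ∑ (suc k) (f i)) + ∑ (suc k) (f k)
      ≡⟨ cong (_+ ∑ (suc k) (f k)) (∑-cong k (λ i → ∑-last k (f i))) ⟩
    ∑ k (λ i → ∑ k (f i) + f i k) + ∑ (suc k) (f k)
      ≡⟨ cong (_+ ∑ (suc k) (f k)) (∑-distrib-+ k (λ i → ∑ k (f i)) (λ i → f i k)) ⟩
    (square-sum f k + ∑ k (λ i → f i k)) + ∑ (suc k) (f k)
      ≡⟨ +-assoc (square-sum f k) (∑ k (λ i → f i k)) (∑ (suc k) (f k)) ⟩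
    square-sum f k + boundary f k ∎
    where open ≡-Reasoning

  square-sum-increment : ∀ f k → square-sum f (suc k) - square-sum f k ≡ boundary f k
  square-sum-increment f k =
    trans (cong (_- square-sum f k) (square-sum-step f k)) (lem (square-sum f k) (boundary f k))
    where
    lem : ∀ a b → (a + b) - a ≡ b
    lem = ℚS.solve 2 (λ a b → (a ℚS.:+ b) ℚS.:- a ℚS.:= b) refl

  square-sum-product : ∀ a b N → ∑ N a * ∑ N b ≡ square-sum (λ i j → a i * b j) N
  square-sum-product a b N = sym (trans (∑-cong N (λ i → ∑-*ˡ N (a i) b)) (∑-*ʳ N (∑ N b) a))

open SeriesLemmas

-- With m = suc i and n = suc j this is the (m, n)-term n⁻ᵖ (2m + n)⁻ᵠ.

ζ₂♯-term : ℕ → ℕ → ℕ → ℕ → ℚ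
ζ₂♯-term p q i j = suc j ^- p * (2 ℕ.* suc i ℕ.+ suc j) ^- q

module DoubleSeries where
  ζ₂♯-cauchy : ∀ p q → 2 ℕ.≤ p → 2 ℕ.≤ q →
    IsCauchy (λ N → ∑[ i < N ] ∑[ j < N ] ζ₂♯-term p q i j)
  ζ₂♯-cauchy p q 2≤p 2≤q = comparison (square-sum f) w mono dom
    (*-cauchy (λ N → ∑ N a) (λ N → ∑ N b)
      (inverse-power-sum-cauchy q 2≤q) (inverse-power-sum-cauchy p 2≤p))
    where
    a b : ℕ → ℚ
    a i = suc i ^- q
    b j = suc j ^- p
    f g : ℕ → ℕ → ℚ
    f = ζ₂♯-term p q
    g i j = a i * b j
    w : ℕ → ℚ
    w N = ∑ N a * ∑ N b
    0≤f : ∀ i j → 0ℚ ≤ f i j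
    0≤f i j = *-mono-≤-nonNeg {0ℚ} {b j} {0ℚ} ≤-refl (0≤^- (suc j) p)
                (0≤^- (suc j) p) (0≤^- (2 ℕ.* suc i ℕ.+ suc j) q)
    f≤g : ∀ i j → f i j ≤ g i j
    f≤g i j = subst (f i j ≤_) (*-comm (b j) (a i))
      (*-monoˡ-≤-nonNeg (b j) {{nonNegative (0≤^- (suc j) p)}}
        (1/-anti (suc i ℕ.^ q) ((2 ℕ.* suc i ℕ.+ suc j) ℕ.^ q)
          {{ℕ.m^n≢0 (suc i) q}} {{ℕ.m^n≢0 (2 ℕ.* suc i ℕ.+ suc j) q}}
          (ℕ.^-monoˡ-≤ q (ℕ.≤-trans (ℕ.m≤m+n (suc i) (suc i ℕ.+ 0)) (ℕ.m≤m+n (2 ℕ.* suc i) (suc j))))))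
    mono : ∀ k → square-sum f k ≤ square-sum f (suc k)
    mono k = subst (square-sum f k ≤_) (sym (square-sum-step f k))
      (x≤x+y (square-sum f k)
        (+-mono-≤ (∑-nonNeg k (λ i → 0≤f i k)) (∑-nonNeg (suc k) (0≤f k))))
    dom : ∀ k → square-sum f (suc k) - square-sum f k ≤ w (suc k) - w k
    dom k = begin
      square-sum f (suc k) - square-sum f k ≡⟨ square-sum-increment f k ⟩
      boundary f k    ≤⟨ +-mono-≤ (∑-mono k (λ i → f≤g i k)) (∑-mono (suc k) (f≤g k)) ⟩
      boundary g k                          ≡⟨ square-sum-increment g k ⟨
      square-sum g (suc k) - square-sum g k
        ≡⟨ cong₂ _-_ (square-sum-product a b (suc k)) (square-sum-product a b k) ⟨
      w (suc k) - w k                       ∎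
      where open ≤-Reasoning

open DoubleSeries

-- The Riemann zeta function at natural numbers.  The value at 0 is that of
-- the analytic continuation; the value at the pole 1 is a dummy.

ζ : ℕ → ℝ
ζ 0               = fromℚ (- ½)
ζ 1               = fromℚ 0ℚ
ζ s@(suc (suc _)) = mkℝ (λ N → ∑[ i < N ] suc i ^- s)
                        (inverse-power-sum-cauchy s (s≤s (s≤s z≤n)))

-- The terms are positive, so the sum of the double series is the limit of
-- the partial sums over the squares 1 ≤ m, n ≤ N.

ζ₂♯ : (p q : ℕ) → 2 ℕ.≤ p → 2 ℕ.≤ q → ℝ
ζ₂♯ p q 2≤p 2≤q = mkℝ (λ N → ∑[ i < N ] ∑[ j < N ] ζ₂♯-term p q i j)
                      (ζ₂♯-cauchy p q 2≤p 2≤q)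

{-# OPTIONS --safe #-}
module Submission where

-- Fix c = 2m and sum n⁻ᵖ (n + c)⁻ᵠ over all integers n ≠ 0, -c.  The ranges
-- n > 0, n < -c and -c < n < 0 give, up to the sign (-1)ᵖ and after summation
-- over m, the left-hand side plus ζ(p + q).  Partial fractions express the
-- same sum through c^-(p+q-k) ∑ n⁻ᵏ: the odd k cancel, and an even k yields
-- 2 ζ(k) minus the excluded term c⁻ᵏ.  By the hockey-stick identity these
-- excluded terms add up to the terms with ζ(0) = -1/2.  Truncating at
-- 1 ≤ m, n ≤ N makes this an exact identity of rationals whose error terms
-- lie between 0 and a constant times 1/N.

-- The obstacle is `k = 1`, where `∑ n⁻ᵏ` diverges: the odd powers have to cancel before any limit
-- is taken. The sum over n is therefore organised by pairs of nonzero integers with sum 2m, and the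
-- unbounded ranges are cut so that the negative entries are exactly -1, ..., -N. Once the excluded
-- entry 2m is put back, the positive entries fill 1, ..., N + 2m without a gap. The k-th power sum
-- of all entries is then `(1 + (-1)ᵏ)` times the sum of `n⁻ᵏ` over n ≤ N, identically zero for odd
-- k, plus a block of 2m terms beyond N.
--
-- For k = 1 this block is only bounded by 2m/N, which is not small for m near N. It comes with the
-- factor (2m) to the power -(p + q - 1), and p, q ≥ 2 make that exponent at least 3 in size, enough
-- to absorb 2m and still sum over m.
--
-- The second error is one of shape: pairs of opposite sign fill the square m, n ≤ N, positive pairs
-- only the triangle m + n ≤ N. Both errors are nonnegative and enter the difference of the two
-- sides with the same sign, so only upper bounds remain to be found.

open import Defs

open CauchyLemmas
open SeriesLemmas

-- Reindexing of finite sums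

module Sums where
  open import Data.Nat.Base as ℕ using (ℕ; zero; suc; ⌊_/2⌋)
  import Data.Nat.Properties as ℕ
  open import Data.Rational.Base
  open import Data.Rational.Properties
  open import Function.Base using (_∘_)
  open import Relation.Binary.PropositionalEquality

  ∑-cong< : ∀ n {f g} → (∀ i → i ℕ.< n → f i ≡ g i) → ∑ n f ≡ ∑ n g
  ∑-cong< zero    f≡g = refl
  ∑-cong< (suc n) f≡g =
    cong₂ _+_ (f≡g 0 ℕ.z<s) (∑-cong< n λ i i<n → f≡g (suc i) (ℕ.s<s i<n))

  ∑-zero : ∀ n → ∑[ i < n ] 0ℚ ≡ 0ℚ
  ∑-zero zero    = refl
  ∑-zero (suc n) = trans (+-identityˡ _) (∑-zero n)

  ∑-split : ∀ m n f → ∑ (m ℕ.+ n) f ≡ ∑ m f + (∑[ i < n ] f (m ℕ.+ i))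
  ∑-split zero    n f = sym (+-identityˡ _)
  ∑-split (suc m) n f =
    trans (cong (f 0 +_) (∑-split m n (f ∘ suc))) (sym (+-assoc (f 0) _ _))

  ∑-swap : ∀ m n (f : ℕ → ℕ → ℚ) → (∑[ i < m ] ∑[ j < n ] f i j) ≡ (∑[ j < n ] ∑[ i < m ] f i j)
  ∑-swap zero    n f = sym (∑-zero n)
  ∑-swap (suc m) n f = trans (cong (∑ n (f 0) +_) (∑-swap m n (f ∘ suc)))
    (sym (∑-distrib-+ n (f 0) λ j → ∑[ i < m ] f (suc i) j))

  ∑-reverse : ∀ n f → ∑ n f ≡ ∑[ i < n ] f (n ℕ.∸ suc i)
  ∑-reverse zero    f = refl
  ∑-reverse (suc n) f = begin
    ∑ (suc n) f                      ≡⟨ ∑-last n f ⟩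
    ∑ n f + f n                      ≡⟨ +-comm (∑ n f) (f n) ⟩
    f n + ∑ n f                      ≡⟨ cong (f n +_) (∑-reverse n f) ⟩
    f n + (∑[ i < n ] f (n ℕ.∸ suc i)) ∎
    where open ≡-Reasoning

  -- Mirror images about `n`, together with the fixed point `n`, fill 0, ..., 2n. This is the shape
  -- of the splittings of 2m into two positive parts, with the equal halves as fixed point.
  ∑-fold : ∀ n f → (∑[ i < n ] f i + f (n ℕ.+ (n ℕ.∸ i))) + f n ≡ ∑ (n ℕ.+ suc n) f
  ∑-fold n f = begin
    (∑[ i < n ] f i + f (n ℕ.+ (n ℕ.∸ i))) + f n
      ≡⟨ cong (_+ f n) (∑-distrib-+ n f λ i → f (n ℕ.+ (n ℕ.∸ i))) ⟩
    (∑ n f + (∑[ i < n ] f (n ℕ.+ (n ℕ.∸ i)))) + f n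
      ≡⟨ cong₂ (λ s t → (∑ n f + s) + t) upper (cong f (ℕ.+-identityʳ n)) ⟨
    (∑ n f + (∑[ i < n ] f (n ℕ.+ suc i))) + f (n ℕ.+ 0)
      ≡⟨ lem (∑ n f) _ _ ⟩
    ∑ n f + (∑[ i < suc n ] f (n ℕ.+ i))
      ≡⟨ ∑-split n (suc n) f ⟨
    ∑ (n ℕ.+ suc n) f ∎
    where
    open ≡-Reasoning
    lem : ∀ a b c → (a + b) + c ≡ a + (c + b)
    lem = ℚS.solve 3 (λ a b c → (a ℚS.:+ b) ℚS.:+ c ℚS.:= a ℚS.:+ (c ℚS.:+ b)) refl
    upper : ∑[ i < n ] f (n ℕ.+ suc i) ≡ ∑[ i < n ] f (n ℕ.+ (n ℕ.∸ i))
    upper = trans (∑-reverse n λ i → f (n ℕ.+ suc i))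
      (∑-cong< n λ i i<n → cong (λ k → f (n ℕ.+ k)) (sym (ℕ.+-∸-assoc 1 i<n)))

  -- For odd `p` the last index is itself odd and its term vanishes, which is why the half is
  -- rounded down.
  ∑-even : ∀ p f → (∀ j → f (suc (2 ℕ.* j)) ≡ 0ℚ) →
           ∑ (suc p) f ≡ ∑[ j < suc ⌊ p /2⌋ ] f (2 ℕ.* j)
  ∑-even 0             f odd = refl
  ∑-even 1             f odd = cong (f 0 +_) (trans (+-identityʳ (f 1)) (odd 0))
  ∑-even (suc (suc p)) f odd = begin
    f 0 + (f 1 + ∑ (suc p) g)
      ≡⟨ cong (λ x → f 0 + (x + ∑ (suc p) g)) (odd 0) ⟩
    f 0 + (0ℚ + ∑ (suc p) g)
      ≡⟨ cong (f 0 +_) (+-identityˡ _) ⟩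
    f 0 + ∑ (suc p) g
      ≡⟨ cong (f 0 +_) (∑-even p g λ j → trans (cong (f ∘ suc) (sym (double j))) (odd (suc j))) ⟩
    f 0 + (∑[ j < suc ⌊ p /2⌋ ] g (2 ℕ.* j))
      ≡⟨ cong (f 0 +_) (∑-cong (suc ⌊ p /2⌋) λ j → cong f (sym (double j))) ⟩
    f 0 + (∑[ j < suc ⌊ p /2⌋ ] f (2 ℕ.* suc j)) ∎
    where
    open ≡-Reasoning
    g = λ k → f (suc (suc k))
    double : ∀ j → 2 ℕ.* suc j ≡ suc (suc (2 ℕ.* j))
    double = ℕ.*-suc 2

  -- Both sides run over `i + j + 1 < n`, once by antidiagonals and once by rows.
  ∑-triangle : ∀ n (f : ℕ → ℕ → ℚ) → (∑[ k < n ] ∑[ i < k ] f i (k ℕ.∸ suc i))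
                       ≡ (∑[ i < n ] ∑[ j < n ℕ.∸ suc i ] f i j)
  ∑-triangle zero    f = refl
  ∑-triangle (suc n) f = begin
    ∑[ k < suc n ] ∑[ i < k ] f i (k ℕ.∸ suc i)
      ≡⟨ ∑-last n (λ k → ∑[ i < k ] f i (k ℕ.∸ suc i)) ⟩
    (∑[ k < n ] ∑[ i < k ] f i (k ℕ.∸ suc i)) + (∑[ i < n ] f i (n ℕ.∸ suc i))
      ≡⟨ cong (_+ (∑[ i < n ] f i (n ℕ.∸ suc i))) (∑-triangle n f) ⟩
    (∑[ i < n ] ∑[ j < n ℕ.∸ suc i ] f i j) + (∑[ i < n ] f i (n ℕ.∸ suc i))
      ≡⟨ ∑-distrib-+ n (λ i → ∑ (n ℕ.∸ suc i) (f i)) (λ i → f i (n ℕ.∸ suc i)) ⟨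
    ∑[ i < n ] ∑ (n ℕ.∸ suc i) (f i) + f i (n ℕ.∸ suc i)
      ≡⟨ ∑-cong n (λ i → ∑-last (n ℕ.∸ suc i) (f i)) ⟨
    ∑[ i < n ] ∑ (suc (n ℕ.∸ suc i)) (f i)
      ≡⟨ ∑-cong< n (λ i i<n → cong (λ k → ∑ k (f i)) (ℕ.+-∸-assoc 1 i<n)) ⟨
    ∑[ i < n ] ∑ (n ℕ.∸ i) (f i)
      -- The row `i = n` is empty; it is added to reach the index range of `suc n`.
      ≡⟨ +-identityʳ _ ⟨
    (∑[ i < n ] ∑ (n ℕ.∸ i) (f i)) + 0ℚ
      ≡⟨ cong (λ k → (∑[ i < n ] ∑ (n ℕ.∸ i) (f i)) + ∑ k (f n)) (ℕ.n∸n≡0 n) ⟨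
    (∑[ i < n ] ∑ (n ℕ.∸ i) (f i)) + ∑ (n ℕ.∸ n) (f n)
      ≡⟨ ∑-last n (λ i → ∑ (n ℕ.∸ i) (f i)) ⟨
    ∑[ i < suc n ] ∑ (n ℕ.∸ i) (f i) ∎
    where open ≡-Reasoning

  seq-∑ᴿ : ∀ n f N → seq (∑ᴿ n f) N ≡ ∑[ j < suc n ] seq (f j) N
  seq-∑ᴿ zero    f N = refl
  seq-∑ᴿ (suc n) f N = cong (seq (f 0) N +_) (seq-∑ᴿ n (f ∘ suc) N)

-- Partial fractions in reciprocals

module PartialFractions where
  open import Algebra.Bundles using (CommutativeRing)
  open import Data.Integer.Base as ℤ using () renaming (+_ to int)
  open import Data.Nat.Base as ℕ using (ℕ; zero; suc; _∸_)
  import Data.Nat.Properties as ℕ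
  open import Data.Nat.Combinatorics using (_C_; nCk≡nC[n∸k]; nCn≡1; nCk+nC[k+1]≡[n+1]C[k+1])
  open import Data.Rational.Base
  open import Data.Rational.Properties
  import Data.Rational.Unnormalised.Base as ℚᵘ
  import Data.Rational.Unnormalised.Properties as ℚᵘ
  open import Relation.Binary.PropositionalEquality
  open import Algebra.Properties.CommutativeSemiring.Exp
    (CommutativeRing.commutativeSemiring +-*-commutativeRing) public
    using (_^_; ^-homo-*; ^-distrib-*)
  open Sums

  κ : ℕ → ℚ
  κ n = int n / 1

  κ-+ : ∀ m n → κ (m ℕ.+ n) ≡ κ m + κ n
  κ-+ m n = toℚᵘ-injective (begin
    toℚᵘ (κ (m ℕ.+ n))                ≈⟨ toℚᵘ-/ (int (m ℕ.+ n)) 1 ⟩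
    int (m ℕ.+ n) ℚᵘ./ 1                ≈⟨ ℚᵘ.*≡* (lem (int m) (int n)) ⟩
    (int m ℚᵘ./ 1) ℚᵘ.+ (int n ℚᵘ./ 1)    ≈⟨ ℚᵘ.+-cong (toℚᵘ-/ (int m) 1) (toℚᵘ-/ (int n) 1) ⟨
    toℚᵘ (κ m) ℚᵘ.+ toℚᵘ (κ n)        ≈⟨ toℚᵘ-homo-+ (κ m) (κ n) ⟨
    toℚᵘ (κ m + κ n)                  ∎)
    where
    open import Relation.Binary.Reasoning.Setoid ℚᵘ.≃-setoid
    lem : ∀ a b → (a ℤ.+ b) ℤ.* int 1 ≡ (a ℤ.* int 1 ℤ.+ b ℤ.* int 1) ℤ.* int 1
    lem = ℤS.solve 2 (λ a b → (a ℤS.:+ b) ℤS.:* ℤS.con (int 1) ℤS.:=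
      (a ℤS.:* ℤS.con (int 1) ℤS.:+ b ℤS.:* ℤS.con (int 1)) ℤS.:* ℤS.con (int 1)) refl

  r-inverse : ∀ n → r n * κ (suc n) ≡ 1ℚ
  r-inverse n = toℚᵘ-injective (begin
    toℚᵘ (r n * κ (suc n))                    ≈⟨ toℚᵘ-homo-* (r n) (κ (suc n)) ⟩
    toℚᵘ (r n) ℚᵘ.* toℚᵘ (κ (suc n))          ≈⟨ ℚᵘ.*-cong (toℚᵘ-/ (int 1) (suc n)) (toℚᵘ-/ (int (suc n)) 1) ⟩
    (int 1 ℚᵘ./ suc n) ℚᵘ.* (int (suc n) ℚᵘ./ 1)    ≈⟨ ℚᵘ.*≡* (lem (int (suc n))) ⟩
    toℚᵘ 1ℚ                                   ∎)
    where
    open import Relation.Binary.Reasoning.Setoid ℚᵘ.≃-setoid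
    lem : ∀ a → (int 1 ℤ.* a) ℤ.* int 1 ≡ int 1 ℤ.* (a ℤ.* int 1)
    lem = ℤS.solve 1 (λ a → (ℤS.con (int 1) ℤS.:* a) ℤS.:* ℤS.con (int 1) ℤS.:=
      ℤS.con (int 1) ℤS.:* (a ℤS.:* ℤS.con (int 1))) refl

  1/-* : ∀ m n .{{_ : ℕ.NonZero m}} .{{_ : ℕ.NonZero n}} →
         (int 1 / (m ℕ.* n)) {{ℕ.m*n≢0 m n}} ≡ (int 1 / m) * (int 1 / n)
  1/-* m@(suc _) n@(suc _) = toℚᵘ-injective (begin
    toℚᵘ (int 1 / (m ℕ.* n))                   ≈⟨ toℚᵘ-/ (int 1) (m ℕ.* n) ⟩
    (int 1 ℚᵘ./ m) ℚᵘ.* (int 1 ℚᵘ./ n)           ≈⟨ ℚᵘ.*-cong (toℚᵘ-/ (int 1) m) (toℚᵘ-/ (int 1) n) ⟨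
    toℚᵘ (int 1 / m) ℚᵘ.* toℚᵘ (int 1 / n)       ≈⟨ toℚᵘ-homo-* (int 1 / m) (int 1 / n) ⟨
    toℚᵘ ((int 1 / m) * (int 1 / n))             ∎)
    where open import Relation.Binary.Reasoning.Setoid ℚᵘ.≃-setoid

  ^-≡^ : ∀ n .{{_ : ℕ.NonZero n}} s → n ^- s ≡ (int 1 / n) ^ s
  ^-≡^ n zero           = refl
  ^-≡^ n {{n≢0}} (suc s) =
    trans (1/-* n (n ℕ.^ s) {{n≢0}} {{ℕ.m^n≢0 n s}})
                                (cong ((int 1 / n) *_) (^-≡^ n s))

  -- Partial fractions are developed for reciprocals x, y, z whose only property is
  -- `z * (x + y) ≡ x * y`. This supplies it for x = 1/A, y = 1/B, z = 1/(A + B) with A = a + 1, B =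
  -- b + 1.
  r-partial : ∀ a b → r (suc (a ℕ.+ b)) * (r a + r b) ≡ r a * r b
  r-partial a b = begin
    s * (r a + r b)                       ≡⟨ cong₂ (λ x y → s * (x + y)) (one* (r a) b) (one* (r b) a) ⟩
    s * (r a * (r b * κ (suc b)) + r b * (r a * κ (suc a)))
                                          ≡⟨ lem s (r a) (r b) (κ (suc a)) (κ (suc b)) ⟩
    s * (κ (suc a) + κ (suc b)) * (r a * r b)
                                          ≡⟨ cong (λ x → s * x * (r a * r b)) (κ-+ (suc a) (suc b)) ⟨
    s * κ (suc a ℕ.+ suc b) * (r a * r b) ≡⟨ cong (λ n → s * κ (suc n) * (r a * r b)) (ℕ.+-suc a b) ⟩
    s * κ (suc (suc (a ℕ.+ b))) * (r a * r b)
                                          ≡⟨ cong (_* (r a * r b)) (r-inverse (suc (a ℕ.+ b))) ⟩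
    1ℚ * (r a * r b)                      ≡⟨ *-identityˡ _ ⟩
    r a * r b                             ∎
    where
    open ≡-Reasoning
    s = r (suc (a ℕ.+ b))
    one* : ∀ x n → x ≡ x * (r n * κ (suc n))
    one* x n = sym (trans (cong (x *_) (r-inverse n)) (*-identityʳ x))
    lem : ∀ s x y a b → s * (x * (y * b) + y * (x * a)) ≡ s * (a + b) * (x * y)
    lem = ℚS.solve 5 (λ s x y a b →
      s ℚS.:* (x ℚS.:* (y ℚS.:* b) ℚS.:+ y ℚS.:* (x ℚS.:* a))
        ℚS.:= s ℚS.:* (a ℚS.:+ b) ℚS.:* (x ℚS.:* y)) refl

  -- For x y = z (x + y) the partial fraction expansion of x^(P+1) y^(Q+1) is
  -- R P Q z (x ^_) + R Q P z (y ^_); the power of x is indexed downwards so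
  -- that the recursion in P and Q needs no bound on l.
  R-term : ℕ → ℕ → ℚ → (ℕ → ℚ) → ℕ → ℚ
  R-term P Q z X l = κ ((l ℕ.+ Q) C Q) * z ^ (l ℕ.+ suc Q) * X (suc (P ∸ l))

  R : ℕ → ℕ → ℚ → (ℕ → ℚ) → ℚ
  R P Q z X = ∑ (suc P) (R-term P Q z X)

  nC0≡1 : ∀ n → n C 0 ≡ 1
  nC0≡1 n = trans (nCk≡nC[n∸k] {0} {n} ℕ.z≤n) (nCn≡1 n)

  pascal : ∀ m n → (suc m ℕ.+ suc n) C suc n ≡ (suc m ℕ.+ n) C n ℕ.+ (m ℕ.+ suc n) C suc n
  pascal m n = trans (sym (nCk+nC[k+1]≡[n+1]C[k+1] (m ℕ.+ suc n) n))
    (cong (λ k → k C n ℕ.+ (m ℕ.+ suc n) C suc n) (ℕ.+-suc m n))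

  pull-factor : ∀ k z y x → k * (z * y) * x ≡ z * (k * y * x)
  pull-factor = ℚS.solve 4 (λ k z y x → k ℚS.:* (z ℚS.:* y) ℚS.:* x
    ℚS.:= z ℚS.:* (k ℚS.:* y ℚS.:* x)) refl

  -- Pascal's rule on the coefficients: lowering `Q` keeps the index `l`, lowering `P` shifts it by
  -- one, and the two binomials meeting at `suc l` add up. The term `l = 0` comes from the first
  -- part alone.
  R-step : ∀ P Q z X → R (suc P) (suc Q) z X ≡ z * (R (suc P) Q z X + R P (suc Q) z X)
  R-step P Q z X = begin
    R (suc P) (suc Q) z X
      ≡⟨ cong₂ _+_ first (∑-cong (suc P) rest) ⟩
    z * u 0 + (∑[ l < suc P ] z * (u (suc l) + v l))
      ≡⟨ cong ((z * u 0) +_) (trans (∑-*ˡ (suc P) z λ l → u (suc l) + v l)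
           (cong (z *_) (∑-distrib-+ (suc P) (λ l → u (suc l)) v))) ⟩
    z * u 0 + z * ((∑[ l < suc P ] u (suc l)) + ∑ (suc P) v)
      ≡⟨ lem z (u 0) _ _ ⟩
    z * (R (suc P) Q z X + R P (suc Q) z X) ∎
    where
    open ≡-Reasoning
    u v : ℕ → ℚ
    u = R-term (suc P) Q z X
    v = R-term P (suc Q) z X
    lem : ∀ z a b c → z * a + z * (b + c) ≡ z * ((a + b) + c)
    lem = ℚS.solve 4 (λ z a b c → z ℚS.:* a ℚS.:+ z ℚS.:* (b ℚS.:+ c)
      ℚS.:= z ℚS.:* ((a ℚS.:+ b) ℚS.:+ c)) refl
    lem₂ : ∀ a b z y x → (a + b) * (z * y) * x ≡ z * (a * y * x + b * y * x)
    lem₂ = ℚS.solve 5 (λ a b z y x → (a ℚS.:+ b) ℚS.:* (z ℚS.:* y) ℚS.:* x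
      ℚS.:= z ℚS.:* (a ℚS.:* y ℚS.:* x ℚS.:+ b ℚS.:* y ℚS.:* x)) refl
    first : R-term (suc P) (suc Q) z X 0 ≡ z * u 0
    first = trans
      (cong (λ k → κ k * z ^ suc (suc Q) * X (suc (suc P)))
        (trans (nCn≡1 (suc Q)) (sym (nCn≡1 Q))))
      (pull-factor (κ (Q C Q)) z (z ^ suc Q) (X (suc (suc P))))
    rest : ∀ l → R-term (suc P) (suc Q) z X (suc l) ≡ z * (u (suc l) + v l)
    rest l = begin
      κ ((suc l ℕ.+ suc Q) C suc Q) * (z * y) * x
        ≡⟨ cong (λ k → k * (z * y) * x) (trans (cong κ (pascal l Q)) (κ-+ a b)) ⟩
      (κ a + κ b) * (z * y) * x
        ≡⟨ lem₂ (κ a) (κ b) z y x ⟩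
      z * (κ a * y * x + κ b * y * x)
        ≡⟨ cong (λ n → z * (κ a * z ^ n * x + κ b * y * x)) (ℕ.+-suc l (suc Q)) ⟩
      z * (u (suc l) + v l) ∎
      where
      a = (suc l ℕ.+ Q) C Q
      b = (l ℕ.+ suc Q) C suc Q
      y = z ^ (l ℕ.+ suc (suc Q))
      x = X (suc (P ∸ l))

  -- At exponent 1 of y, one of the two summands loses y altogether; the pure power of x left behind
  -- is the new term `l = 0`.
  R-step-zeroʳ : ∀ P z X → R (suc P) 0 z X ≡ z * (X (suc (suc P)) + R P 0 z X)
  R-step-zeroʳ P z X = begin
    R (suc P) 0 z X
      ≡⟨ cong₂ _+_ (lem₀ z (X (suc (suc P)))) (∑-cong (suc P) rest) ⟩
    z * X (suc (suc P)) + (∑[ l < suc P ] z * v l)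
      ≡⟨ cong ((z * X (suc (suc P))) +_) (∑-*ˡ (suc P) z v) ⟩
    z * X (suc (suc P)) + z * ∑ (suc P) v
      ≡⟨ *-distribˡ-+ z _ _ ⟨
    z * (X (suc (suc P)) + R P 0 z X) ∎
    where
    open ≡-Reasoning
    v : ℕ → ℚ
    v = R-term P 0 z X
    lem₀ : ∀ z x → 1ℚ * (z * 1ℚ) * x ≡ z * x
    lem₀ = ℚS.solve 2 (λ z x → ℚS.con 1ℚ ℚS.:* (z ℚS.:* ℚS.con 1ℚ) ℚS.:* x
      ℚS.:= z ℚS.:* x) refl
    rest : ∀ l → R-term (suc P) 0 z X (suc l) ≡ z * v l
    rest l = trans
      (cong (λ k → κ k * z ^ (suc l ℕ.+ 1) * X (suc (P ∸ l)))
        (trans (nC0≡1 (suc l ℕ.+ 0)) (sym (nC0≡1 (l ℕ.+ 0)))))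
      (pull-factor (κ ((l ℕ.+ 0) C 0)) z (z ^ (l ℕ.+ 1)) (X (suc (P ∸ l))))

  R-step-zeroˡ : ∀ Q z X → R 0 (suc Q) z X ≡ z * R 0 Q z X
  R-step-zeroˡ Q z X = trans
    (cong (λ k → κ k * z ^ suc (suc Q) * X 1 + 0ℚ)
      (trans (nCn≡1 (suc Q)) (sym (nCn≡1 Q))))
    (lem (κ (Q C Q)) z (z ^ suc Q) (X 1))
    where
    lem : ∀ k z y x → k * (z * y) * x + 0ℚ ≡ z * (k * y * x + 0ℚ)
    lem = ℚS.solve 4 (λ k z y x → k ℚS.:* (z ℚS.:* y) ℚS.:* x ℚS.:+ ℚS.con 0ℚ
      ℚS.:= z ℚS.:* (k ℚS.:* y ℚS.:* x ℚS.:+ ℚS.con 0ℚ)) refl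

  module _ where
    open ≡-Reasoning

    partial-fractions₁ : ∀ P x y z → z * (x + y) ≡ x * y →
      x ^ suc P * y ^ 1 ≡ R P 0 z (x ^_) + R 0 P z (y ^_)
    partial-fractions₁ zero x y z h = begin
      x ^ 1 * y ^ 1                   ≡⟨ lem₁ x y ⟩
      x * y                           ≡⟨ h ⟨
      z * (x + y)                     ≡⟨ lem₂ x y z ⟩
      R 0 0 z (x ^_) + R 0 0 z (y ^_) ∎
      where
      lem₁ : ∀ x y → (x * 1ℚ) * (y * 1ℚ) ≡ x * y
      lem₁ x y = cong₂ _*_ (*-identityʳ x) (*-identityʳ y)
      lem₂ : ∀ x y z → z * (x + y) ≡
        (1ℚ * (z * 1ℚ) * (x * 1ℚ) + 0ℚ) + (1ℚ * (z * 1ℚ) * (y * 1ℚ) + 0ℚ)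
      lem₂ = ℚS.solve 3 (λ x y z → let 1′ = ℚS.con 1ℚ ; 0′ = ℚS.con 0ℚ in
        z ℚS.:* (x ℚS.:+ y) ℚS.:=
        (1′ ℚS.:* (z ℚS.:* 1′) ℚS.:* (x ℚS.:* 1′) ℚS.:+ 0′) ℚS.:+
        (1′ ℚS.:* (z ℚS.:* 1′) ℚS.:* (y ℚS.:* 1′) ℚS.:+ 0′)) refl
    partial-fractions₁ (suc P) x y z h = begin
      x * x ^ suc P * y ^ 1                          ≡⟨ lem₁ x (x ^ suc P) y ⟩
      x ^ suc P * (x * y)                            ≡⟨ cong ((x ^ suc P) *_) h ⟨
      x ^ suc P * (z * (x + y))                      ≡⟨ lem₂ (x ^ suc P) x y z ⟩
      z * (x * x ^ suc P + x ^ suc P * y ^ 1)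
        ≡⟨ cong (λ t → z * (x * x ^ suc P + t)) (partial-fractions₁ P x y z h) ⟩
      z * (x * x ^ suc P + (R P 0 z (x ^_) + R 0 P z (y ^_)))
        ≡⟨ lem₃ z (x * x ^ suc P) (R P 0 z (x ^_)) (R 0 P z (y ^_)) ⟩
      z * (x * x ^ suc P + R P 0 z (x ^_)) + z * R 0 P z (y ^_)
        ≡⟨ cong₂ _+_ (R-step-zeroʳ P z (x ^_)) (R-step-zeroˡ P z (y ^_)) ⟨
      R (suc P) 0 z (x ^_) + R 0 (suc P) z (y ^_)    ∎
      where
      lem₁ : ∀ x a y → x * a * (y * 1ℚ) ≡ a * (x * y)
      lem₁ = ℚS.solve 3 (λ x a y → x ℚS.:* a ℚS.:* (y ℚS.:* ℚS.con 1ℚ)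
        ℚS.:= a ℚS.:* (x ℚS.:* y)) refl
      lem₂ : ∀ a x y z → a * (z * (x + y)) ≡ z * (x * a + a * (y * 1ℚ))
      lem₂ = ℚS.solve 4 (λ a x y z → a ℚS.:* (z ℚS.:* (x ℚS.:+ y))
        ℚS.:= z ℚS.:* (x ℚS.:* a ℚS.:+ a ℚS.:* (y ℚS.:* ℚS.con 1ℚ))) refl
      lem₃ : ∀ z a b c → z * (a + (b + c)) ≡ z * (a + b) + z * c
      lem₃ = ℚS.solve 4 (λ z a b c → z ℚS.:* (a ℚS.:+ (b ℚS.:+ c))
        ℚS.:= z ℚS.:* (a ℚS.:+ b) ℚS.:+ z ℚS.:* c) refl

    -- Replacing one factor `x * y` by `z * (x + y)` leaves two products of total degree one lower,
    -- and `R` obeys the same recursion. Exponent 1 has an induction of its own because there a pure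
    -- power appears.
    partial-fractions : ∀ P Q x y z → z * (x + y) ≡ x * y →
      x ^ suc P * y ^ suc Q ≡ R P Q z (x ^_) + R Q P z (y ^_)
    partial-fractions P       zero    x y z h = partial-fractions₁ P x y z h
    partial-fractions zero    (suc Q) x y z h = begin
      x ^ 1 * y ^ suc (suc Q)                       ≡⟨ *-comm (x ^ 1) (y ^ suc (suc Q)) ⟩
      y ^ suc (suc Q) * x ^ 1
        ≡⟨ partial-fractions₁ (suc Q) y x z (trans (cong (z *_) (+-comm y x)) (trans h (*-comm x y))) ⟩
      R (suc Q) 0 z (y ^_) + R 0 (suc Q) z (x ^_)
        ≡⟨ +-comm (R (suc Q) 0 z (y ^_)) (R 0 (suc Q) z (x ^_)) ⟩
      R 0 (suc Q) z (x ^_) + R (suc Q) 0 z (y ^_)   ∎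
    partial-fractions (suc P) (suc Q) x y z h = begin
      (x * a) * (y * b)                             ≡⟨ lem₁ x a y b ⟩
      a * b * (x * y)                               ≡⟨ cong ((a * b) *_) h ⟨
      a * b * (z * (x + y))                         ≡⟨ lem₂ x a y b z ⟩
      z * (x ^ suc (suc P) * y ^ suc Q + x ^ suc P * y ^ suc (suc Q))
        ≡⟨ cong (z *_) (cong₂ _+_ (partial-fractions (suc P) Q x y z h) (partial-fractions P (suc Q) x y z h)) ⟩
      z * ((R (suc P) Q z (x ^_) + R Q (suc P) z (y ^_)) + (R P (suc Q) z (x ^_) + R (suc Q) P z (y ^_)))
        ≡⟨ lem₃ z (R (suc P) Q z (x ^_)) (R Q (suc P) z (y ^_)) (R P (suc Q) z (x ^_)) (R (suc Q) P z (y ^_)) ⟩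
      z * (R (suc P) Q z (x ^_) + R P (suc Q) z (x ^_)) + z * (R (suc Q) P z (y ^_) + R Q (suc P) z (y ^_))
        ≡⟨ cong₂ _+_ (R-step P Q z (x ^_)) (R-step Q P z (y ^_)) ⟨
      R (suc P) (suc Q) z (x ^_) + R (suc Q) (suc P) z (y ^_) ∎
      where
      a = x ^ suc P
      b = y ^ suc Q
      lem₁ : ∀ x a y b → (x * a) * (y * b) ≡ a * b * (x * y)
      lem₁ = ℚS.solve 4 (λ x a y b → (x ℚS.:* a) ℚS.:* (y ℚS.:* b)
        ℚS.:= a ℚS.:* b ℚS.:* (x ℚS.:* y)) refl
      lem₂ : ∀ x a y b z → a * b * (z * (x + y)) ≡ z * ((x * a) * b + a * (y * b))
      lem₂ = ℚS.solve 5 (λ x a y b z → a ℚS.:* b ℚS.:* (z ℚS.:* (x ℚS.:+ y))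
        ℚS.:= z ℚS.:* ((x ℚS.:* a) ℚS.:* b ℚS.:+ a ℚS.:* (y ℚS.:* b))) refl
      lem₃ : ∀ z a b c d → z * ((a + b) + (c + d)) ≡ z * (a + c) + z * (d + b)
      lem₃ = ℚS.solve 5 (λ z a b c d → z ℚS.:* ((a ℚS.:+ b) ℚS.:+ (c ℚS.:+ d))
        ℚS.:= z ℚS.:* (a ℚS.:+ c) ℚS.:+ z ℚS.:* (d ℚS.:+ b)) refl

  R-cong : ∀ P Q z {X Y} → (∀ k → X k ≡ Y k) → R P Q z X ≡ R P Q z Y
  R-cong P Q z X≡Y = ∑-cong (suc P) λ l →
    cong ((κ ((l ℕ.+ Q) C Q) * z ^ (l ℕ.+ suc Q)) *_) (X≡Y (suc (P ∸ l)))

  -- `R` takes an arbitrary sequence `X` in place of the powers of one number, so that it is linear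
  -- in `X` and accepts whole power sums.
  R-+ : ∀ P Q z X Y → R P Q z (λ k → X k + Y k) ≡ R P Q z X + R P Q z Y
  R-+ P Q z X Y = trans
    (∑-cong (suc P) λ l → *-distribˡ-+ (κ ((l ℕ.+ Q) C Q) * z ^ (l ℕ.+ suc Q)) (X (suc (P ∸ l))) (Y (suc (P ∸ l))))
    (∑-distrib-+ (suc P) (R-term P Q z X) (R-term P Q z Y))

  R-∑ : ∀ P Q z n (X : ℕ → ℕ → ℚ) → R P Q z (λ k → ∑[ i < n ] X i k) ≡ ∑[ i < n ] R P Q z (X i)
  R-∑ P Q z n X = trans
    (∑-cong (suc P) λ l → sym (∑-*ˡ n (κ ((l ℕ.+ Q) C Q) * z ^ (l ℕ.+ suc Q)) λ i → X i (suc (P ∸ l))))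
    (∑-swap (suc P) n λ l i → R-term P Q z (X i) l)

  hockey-stick : ∀ P Q → (∑[ l < suc P ] κ ((l ℕ.+ Q) C Q)) ≡ κ ((P ℕ.+ suc Q) C suc Q)
  hockey-stick zero    Q = trans (+-identityʳ _) (cong κ (trans (nCn≡1 Q) (sym (nCn≡1 (suc Q)))))
  hockey-stick (suc P) Q = begin
    ∑[ l < suc (suc P) ] κ ((l ℕ.+ Q) C Q)
      ≡⟨ ∑-last (suc P) (λ l → κ ((l ℕ.+ Q) C Q)) ⟩
    (∑[ l < suc P ] κ ((l ℕ.+ Q) C Q)) + κ ((suc P ℕ.+ Q) C Q)
      ≡⟨ cong (_+ κ ((suc P ℕ.+ Q) C Q)) (hockey-stick P Q) ⟩
    κ ((P ℕ.+ suc Q) C suc Q) + κ ((suc P ℕ.+ Q) C Q)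
      ≡⟨ +-comm (κ ((P ℕ.+ suc Q) C suc Q)) _ ⟩
    κ ((suc P ℕ.+ Q) C Q) + κ ((P ℕ.+ suc Q) C suc Q)
      ≡⟨ κ-+ ((suc P ℕ.+ Q) C Q) _ ⟨
    κ ((suc P ℕ.+ Q) C Q ℕ.+ (P ℕ.+ suc Q) C suc Q)
      ≡⟨ cong κ (pascal P Q) ⟨
    κ ((suc P ℕ.+ suc Q) C suc Q) ∎
    where open ≡-Reasoning

  -- All terms share the same power of `z`, so only the sum of the coefficients is left. The lower
  -- index `P` is chosen to agree with the coefficient of ζ(0) in the sum over j ≤ [q/2].
  R-diagonal : ∀ P Q z → R P Q z (z ^_) ≡ κ ((P ℕ.+ suc Q) C P) * z ^ (suc P ℕ.+ suc Q)
  R-diagonal P Q z = begin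
    R P Q z (z ^_)
      ≡⟨ ∑-cong< (suc P) (λ l l<p → trans (*-assoc (κ ((l ℕ.+ Q) C Q)) (z ^ (l ℕ.+ suc Q)) (z ^ suc (P ∸ l)))
           (cong (κ ((l ℕ.+ Q) C Q) *_) (trans (sym (^-homo-* z (l ℕ.+ suc Q) (suc (P ∸ l))))
             (cong (z ^_) (exponent l (ℕ.s≤s⁻¹ l<p)))))) ⟩
    ∑[ l < suc P ] κ ((l ℕ.+ Q) C Q) * z ^ (suc P ℕ.+ suc Q)
      ≡⟨ ∑-*ʳ (suc P) (z ^ (suc P ℕ.+ suc Q)) (λ l → κ ((l ℕ.+ Q) C Q)) ⟩
    (∑[ l < suc P ] κ ((l ℕ.+ Q) C Q)) * z ^ (suc P ℕ.+ suc Q)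
      ≡⟨ cong (_* (z ^ (suc P ℕ.+ suc Q))) (trans (hockey-stick P Q) (cong κ symmetric)) ⟩
    κ ((P ℕ.+ suc Q) C P) * z ^ (suc P ℕ.+ suc Q) ∎
    where
    open ≡-Reasoning
    exponent : ∀ l → l ℕ.≤ P → (l ℕ.+ suc Q) ℕ.+ suc (P ∸ l) ≡ suc P ℕ.+ suc Q
    exponent l l≤P = begin
      (l ℕ.+ suc Q) ℕ.+ suc (P ∸ l)  ≡⟨ ℕ.+-assoc l (suc Q) _ ⟩
      l ℕ.+ (suc Q ℕ.+ suc (P ∸ l))  ≡⟨ cong (l ℕ.+_) (ℕ.+-comm (suc Q) _) ⟩
      l ℕ.+ (suc (P ∸ l) ℕ.+ suc Q)  ≡⟨ ℕ.+-assoc l _ (suc Q) ⟨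
      (l ℕ.+ suc (P ∸ l)) ℕ.+ suc Q  ≡⟨ cong (ℕ._+ suc Q) (ℕ.+-suc l (P ∸ l)) ⟩
      suc (l ℕ.+ (P ∸ l)) ℕ.+ suc Q  ≡⟨ cong (λ k → suc k ℕ.+ suc Q) (ℕ.m+[n∸m]≡n l≤P) ⟩
      suc P ℕ.+ suc Q                ∎
    symmetric : (P ℕ.+ suc Q) C suc Q ≡ (P ℕ.+ suc Q) C P
    symmetric = trans (nCk≡nC[n∸k] (ℕ.m≤n+m (suc Q) P))
                      (cong ((P ℕ.+ suc Q) C_) (ℕ.m+n∸n≡m P (suc Q)))

-- The exact identity for truncated sums

module TruncatedIdentity where
  open import Data.Nat.Base as ℕ using (ℕ; suc; _∸_)
  import Data.Nat.Properties as ℕ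
  open import Data.Nat.Combinatorics using (_C_)
  open import Data.Rational.Base
  open import Data.Rational.Properties
  open import Relation.Binary.PropositionalEquality
  open ≡-Reasoning
  open Sums
  open PartialFractions

  σ : ℚ
  σ = - 1ℚ

  -- For m = suc M one has r (c M) = 1 / (2m).
  c : ℕ → ℕ
  c M = M ℕ.+ suc M

  H : ℕ → ℕ → ℚ
  H k n = ∑[ i < n ] r i ^ k

  L : ℕ → ℕ → ℚ → (ℕ → ℚ) → ℚ
  L P Q z X = R P Q z X + R Q P z X

  interchange : ∀ a b c d → (a + b) + (c + d) ≡ (a + c) + (b + d)
  interchange = ℚS.solve 4 (λ a b c d → (a ℚS.:+ b) ℚS.:+ (c ℚS.:+ d)
    ℚS.:= (a ℚS.:+ c) ℚS.:+ (b ℚS.:+ d)) refl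

  L-cong : ∀ P Q z {X Y} → (∀ k → X k ≡ Y k) → L P Q z X ≡ L P Q z Y
  L-cong P Q z X≡Y = cong₂ _+_ (R-cong P Q z X≡Y) (R-cong Q P z X≡Y)

  L-+ : ∀ P Q z X Y → L P Q z (λ k → X k + Y k) ≡ L P Q z X + L P Q z Y
  L-+ P Q z X Y = trans (cong₂ _+_ (R-+ P Q z X Y) (R-+ Q P z X Y))
    (interchange (R P Q z X) (R P Q z Y) (R Q P z X) (R Q P z Y))

  L-∑ : ∀ P Q z n (X : ℕ → ℕ → ℚ) → L P Q z (λ k → ∑[ i < n ] X i k) ≡ ∑[ i < n ] L P Q z (X i)
  L-∑ P Q z n X = trans (cong₂ _+_ (R-∑ P Q z n X) (R-∑ Q P z n X))
    (sym (∑-distrib-+ n (λ i → R P Q z (X i)) (λ i → R Q P z (X i))))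

  G : ℕ → ℕ → ℚ → ℚ → ℚ
  G p q x y = x ^ p * y ^ q + y ^ p * x ^ q

  -- One expansion puts `R P Q` on x and `R Q P` on y. Adding the copy with x and y exchanged puts
  -- both on `x ^ k + y ^ k`, so that power sums can be collected over all pairs.
  G≡L : ∀ P Q x y z → z * (x + y) ≡ x * y → G (suc P) (suc Q) x y ≡ L P Q z (λ k → x ^ k + y ^ k)
  G≡L P Q x y z h = begin
    x ^ suc P * y ^ suc Q + y ^ suc P * x ^ suc Q
      ≡⟨ cong₂ _+_ (partial-fractions P Q x y z h)
           (partial-fractions P Q y x z (trans (cong (z *_) (+-comm y x)) (trans h (*-comm x y)))) ⟩
    (R P Q z (x ^_) + R Q P z (y ^_)) + (R P Q z (y ^_) + R Q P z (x ^_))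
      ≡⟨ lem (R P Q z (x ^_)) (R Q P z (y ^_)) (R P Q z (y ^_)) (R Q P z (x ^_)) ⟩
    L P Q z (x ^_) + L P Q z (y ^_)
      ≡⟨ L-+ P Q z (x ^_) (y ^_) ⟨
    L P Q z (λ k → x ^ k + y ^ k) ∎
    where
    lem : ∀ a b c d → (a + b) + (c + d) ≡ (a + d) + (c + b)
    lem = ℚS.solve 4 (λ a b c d → (a ℚS.:+ b) ℚS.:+ (c ℚS.:+ d)
      ℚS.:= (a ℚS.:+ d) ℚS.:+ (c ℚS.:+ b)) refl

  -- f p q M i is the summand n⁻ᵖ (2m + n)⁻ᵠ with m = suc M, n = suc i.
  f : ℕ → ℕ → ℕ → ℕ → ℚ
  f p q M i = r i ^ p * r (suc (c M) ℕ.+ i) ^ q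

  -- The pairs -n, 2m + n of opposite sign, in both orders.
  outer : ℕ → ℕ → ℕ → ℕ → ℚ
  outer p q N M = ∑[ i < N ] G p q (σ * r i) (r (suc (c M) ℕ.+ i))

  -- The pairs n, 2m - n of positive integers; m, m stands apart because it has only one order.
  inner : ℕ → ℕ → ℕ → ℚ
  inner p q M = (∑[ i < M ] G p q (r i) (r (M ℕ.+ (M ∸ i)))) + r M ^ p * r M ^ q

  h : ℕ → ℕ → ℚ
  h N k = (1ℚ + σ ^ k) * H k N

  -- The block N + 1, ..., N + 2m: the entries 2m + n reach N + 2m, while the entries -n stop at -N.
  e : ℕ → ℕ → ℕ → ℚ
  e N M k = ∑[ i < suc (c M) ] r (N ℕ.+ i) ^ k

  outer-relation : ∀ M i → let x = σ * r i ; y = r (suc (c M) ℕ.+ i) in r (c M) * (x + y) ≡ x * y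
  outer-relation M i = begin
    z * (σ * a + y)          ≡⟨ lem₁ z a y ⟩
    y * z - a * z            ≡⟨ cong (λ t → y * z - t) rel ⟨
    y * z - y * (a + z)      ≡⟨ lem₂ z a y ⟩
    σ * a * y                ∎
    where
    a = r i
    z = r (c M)
    y = r (suc (c M) ℕ.+ i)
    rel : y * (a + z) ≡ a * z
    rel = trans (cong (λ n → r n * (a + z)) (cong suc (ℕ.+-comm (c M) i))) (r-partial i (c M))
    lem₁ : ∀ z a y → z * (σ * a + y) ≡ y * z - a * z
    lem₁ = ℚS.solve 3 (λ z a y → z ℚS.:* (ℚS.con σ ℚS.:* a ℚS.:+ y)
      ℚS.:= y ℚS.:* z ℚS.:- a ℚS.:* z) refl
    lem₂ : ∀ z a y → y * z - y * (a + z) ≡ σ * a * y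
    lem₂ = ℚS.solve 3 (λ z a y → y ℚS.:* z ℚS.:- y ℚS.:* (a ℚS.:+ z)
      ℚS.:= ℚS.con σ ℚS.:* a ℚS.:* y) refl

  inner-relation : ∀ M i → i ℕ.≤ M → let x = r i ; y = r (M ℕ.+ (M ∸ i)) in r (c M) * (x + y) ≡ x * y
  inner-relation M i i≤M = trans
    (cong (λ n → r n * (r i + r (M ℕ.+ (M ∸ i)))) eq)
    (r-partial i (M ℕ.+ (M ∸ i)))
    where
    eq : M ℕ.+ suc M ≡ suc (i ℕ.+ (M ℕ.+ (M ∸ i)))
    eq = begin
      M ℕ.+ suc M                  ≡⟨ ℕ.+-suc M M ⟩
      suc (M ℕ.+ M)                ≡⟨ cong (λ k → suc (M ℕ.+ k)) (ℕ.m+[n∸m]≡n i≤M) ⟨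
      suc (M ℕ.+ (i ℕ.+ (M ∸ i)))  ≡⟨ cong suc (ℕ.+-assoc M i (M ∸ i)) ⟨
      suc (M ℕ.+ i ℕ.+ (M ∸ i))    ≡⟨ cong (λ k → suc (k ℕ.+ (M ∸ i))) (ℕ.+-comm M i) ⟩
      suc (i ℕ.+ M ℕ.+ (M ∸ i))    ≡⟨ cong suc (ℕ.+-assoc i M (M ∸ i)) ⟩
      suc (i ℕ.+ (M ℕ.+ (M ∸ i)))  ∎

  -- The summand `r (c M) ^ k` closes the gap at 2m between 1, ..., 2m - 1 and 2m + 1, ..., 2m + N.
  -- The first N positive entries then cancel or double the negative ones, according to the parity
  -- of `k`.
  power-sums : ∀ N M k →
    (∑[ i < N ] (σ * r i) ^ k + r (suc (c M) ℕ.+ i) ^ k)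
      + ((∑[ i < M ] r i ^ k + r (M ℕ.+ (M ∸ i)) ^ k) + r M ^ k)
      + r (c M) ^ k ≡ h N k + e N M k
  power-sums N M k = begin
    (∑[ i < N ] (σ * r i) ^ k + r (suc (c M) ℕ.+ i) ^ k)
      + ((∑[ i < M ] r i ^ k + r (M ℕ.+ (M ∸ i)) ^ k) + r M ^ k) + r (c M) ^ k
      ≡⟨ cong₂ (λ a b → a + b + r (c M) ^ k) split (∑-fold M (λ i → r i ^ k)) ⟩
    (σ ^ k * H k N + Y) + H k (c M) + r (c M) ^ k
      ≡⟨ lem₁ (σ ^ k * H k N) Y (H k (c M)) (r (c M) ^ k) ⟩
    σ ^ k * H k N + ((H k (c M) + r (c M) ^ k) + Y)
      ≡⟨ cong ((σ ^ k * H k N) +_) shift ⟩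
    σ ^ k * H k N + (H k N + e N M k)
      ≡⟨ lem₂ (σ ^ k) (H k N) (e N M k) ⟩
    h N k + e N M k ∎
    where
    Y = ∑[ i < N ] r (suc (c M) ℕ.+ i) ^ k
    lem₁ : ∀ s y a b → (s + y) + a + b ≡ s + ((a + b) + y)
    lem₁ = ℚS.solve 4 (λ s y a b → (s ℚS.:+ y) ℚS.:+ a ℚS.:+ b
      ℚS.:= s ℚS.:+ ((a ℚS.:+ b) ℚS.:+ y)) refl
    lem₂ : ∀ s a b → s * a + (a + b) ≡ (1ℚ + s) * a + b
    lem₂ = ℚS.solve 3 (λ s a b → s ℚS.:* a ℚS.:+ (a ℚS.:+ b)
      ℚS.:= (ℚS.con 1ℚ ℚS.:+ s) ℚS.:* a ℚS.:+ b) refl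
    split : (∑[ i < N ] (σ * r i) ^ k + r (suc (c M) ℕ.+ i) ^ k) ≡ σ ^ k * H k N + Y
    split = trans
      (∑-distrib-+ N (λ i → (σ * r i) ^ k) (λ i → r (suc (c M) ℕ.+ i) ^ k))
      (cong (_+ Y) (trans (∑-cong N (λ i → ^-distrib-* σ (r i) k)) (∑-*ˡ N (σ ^ k) (λ i → r i ^ k))))
    shift : (H k (c M) + r (c M) ^ k) + Y ≡ H k N + e N M k
    shift = begin
      (H k (c M) + r (c M) ^ k) + Y  ≡⟨ cong (_+ Y) (∑-last (c M) (λ i → r i ^ k)) ⟨
      H k (suc (c M)) + Y            ≡⟨ ∑-split (suc (c M)) N (λ i → r i ^ k) ⟨
      H k (suc (c M) ℕ.+ N)          ≡⟨ cong (H k) (ℕ.+-comm (suc (c M)) N) ⟩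
      H k (N ℕ.+ suc (c M))          ≡⟨ ∑-split N (suc (c M)) (λ i → r i ^ k) ⟩
      H k N + e N M k                ∎

  diagonal-coefficient : ℕ → ℕ → ℚ → ℚ
  diagonal-coefficient P Q z = κ ((P ℕ.+ suc Q) C P) * z ^ (suc P ℕ.+ suc Q)

  -- By `R-diagonal` the two coefficients are `L P Q z (z ^_)`, the contribution of the entry 2m;
  -- linearity of `L` reduces the rest to `power-sums`.
  level-identity : ∀ P Q N M →
    (outer (suc P) (suc Q) N M + inner (suc P) (suc Q) M)
      + (diagonal-coefficient P Q (r (c M)) + diagonal-coefficient Q P (r (c M)))
    ≡ L P Q (r (c M)) (h N) + L P Q (r (c M)) (e N M)
  level-identity P Q N M = begin
    (outer (suc P) (suc Q) N M + inner (suc P) (suc Q) M)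
      + (diagonal-coefficient P Q z + diagonal-coefficient Q P z)
      ≡⟨ cong₂ _+_
           (cong₂ _+_ outer≡ (cong₂ _+_ inner≡ (partial-fractions P Q (r M) (r M) z middle)))
           (sym (cong₂ _+_ (R-diagonal P Q z) (R-diagonal Q P z))) ⟩
    (L P Q z X₁ + (L P Q z X₂ + L P Q z X₃)) + L P Q z (z ^_)
      ≡⟨ cong (λ t → (L P Q z X₁ + t) + L P Q z (z ^_)) (L-+ P Q z X₂ X₃) ⟨
    (L P Q z X₁ + L P Q z (λ k → X₂ k + X₃ k)) + L P Q z (z ^_)
      ≡⟨ cong (_+ L P Q z (z ^_)) (L-+ P Q z X₁ (λ k → X₂ k + X₃ k)) ⟨
    L P Q z (λ k → X₁ k + (X₂ k + X₃ k)) + L P Q z (z ^_)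
      ≡⟨ L-+ P Q z (λ k → X₁ k + (X₂ k + X₃ k)) (z ^_) ⟨
    L P Q z (λ k → X₁ k + (X₂ k + X₃ k) + z ^ k)
      ≡⟨ L-cong P Q z (power-sums N M) ⟩
    L P Q z (λ k → h N k + e N M k)
      ≡⟨ L-+ P Q z (h N) (e N M) ⟩
    L P Q z (h N) + L P Q z (e N M) ∎
    where
    z = r (c M)
    X₁ X₂ X₃ : ℕ → ℚ
    X₁ k = ∑[ i < N ] (σ * r i) ^ k + r (suc (c M) ℕ.+ i) ^ k
    X₂ k = ∑[ i < M ] r i ^ k + r (M ℕ.+ (M ∸ i)) ^ k
    X₃ k = r M ^ k
    -- For x = y a single expansion already has the form `L P Q z X₃`, as befits a pair with only
    -- one order.
    middle : z * (r M + r M) ≡ r M * r M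
    middle = trans (cong (λ n → r n * (r M + r M)) (ℕ.+-suc M M)) (r-partial M M)
    outer≡ : outer (suc P) (suc Q) N M ≡ L P Q z X₁
    outer≡ = trans
      (∑-cong N λ i → G≡L P Q (σ * r i) (r (suc (c M) ℕ.+ i)) z (outer-relation M i))
      (sym (L-∑ P Q z N λ i k → (σ * r i) ^ k + r (suc (c M) ℕ.+ i) ^ k))
    inner≡ : (∑[ i < M ] G (suc P) (suc Q) (r i) (r (M ℕ.+ (M ∸ i)))) ≡ L P Q z X₂
    inner≡ = trans
      (∑-cong< M λ i i<M → G≡L P Q (r i) (r (M ℕ.+ (M ∸ i))) z (inner-relation M i (ℕ.<⇒≤ i<M)))
      (sym (L-∑ P Q z M λ i k → r i ^ k + r (M ℕ.+ (M ∸ i)) ^ k))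

  -- S sums f over the square m, n ≤ N, and T over the triangle m + n ≤ N.
  S T U : ℕ → ℕ → ℕ → ℚ
  S p q N = ∑[ M < N ] ∑[ i < N ] f p q M i
  T p q N = ∑[ i < N ] ∑[ j < N ∸ suc i ] f p q j i
  U p q N = ∑[ i < N ] ∑[ l < suc i ] f p q (N ∸ suc i ℕ.+ l) i

  -- `U` is the part m + n > N of the square, listed by n.
  S≡T+U : ∀ p q N → S p q N ≡ T p q N + U p q N
  S≡T+U p q N = begin
    S p q N
      ≡⟨ ∑-swap N N (f p q) ⟩
    ∑[ i < N ] ∑[ j < N ] f p q j i
      ≡⟨ ∑-cong< N (λ i i<N → trans
           (cong (λ n → ∑[ j < n ] f p q j i) (sym (ℕ.m∸n+n≡m i<N)))
           (∑-split (N ∸ suc i) (suc i) (λ j → f p q j i))) ⟩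
    ∑[ i < N ] (∑[ j < N ∸ suc i ] f p q j i) + (∑[ l < suc i ] f p q (N ∸ suc i ℕ.+ l) i)
      ≡⟨ ∑-distrib-+ N (λ i → ∑[ j < N ∸ suc i ] f p q j i)
           (λ i → ∑[ l < suc i ] f p q (N ∸ suc i ℕ.+ l) i) ⟩
    T p q N + U p q N ∎

  ∑-outer : ∀ p q N → ∑ N (outer p q N) ≡ σ ^ p * S p q N + σ ^ q * S q p N
  ∑-outer p q N = begin
    ∑ N (outer p q N)
      ≡⟨ ∑-cong N (λ M → trans (∑-cong N (λ i → expand i (r (suc (c M) ℕ.+ i))))
           (trans (∑-distrib-+ N (λ i → σ ^ p * f p q M i) (λ i → σ ^ q * f q p M i))
             (cong₂ _+_ (∑-*ˡ N (σ ^ p) (f p q M)) (∑-*ˡ N (σ ^ q) (f q p M))))) ⟩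
    ∑[ M < N ] σ ^ p * ∑ N (f p q M) + σ ^ q * ∑ N (f q p M)
      ≡⟨ ∑-distrib-+ N (λ M → σ ^ p * ∑ N (f p q M)) (λ M → σ ^ q * ∑ N (f q p M)) ⟩
    (∑[ M < N ] σ ^ p * ∑ N (f p q M)) + (∑[ M < N ] σ ^ q * ∑ N (f q p M))
      ≡⟨ cong₂ _+_ (∑-*ˡ N (σ ^ p) (λ M → ∑ N (f p q M))) (∑-*ˡ N (σ ^ q) (λ M → ∑ N (f q p M))) ⟩
    σ ^ p * S p q N + σ ^ q * S q p N ∎
    where
    lem : ∀ s t a b y w → (s * a) * y + w * (t * b) ≡ s * (a * y) + t * (b * w)
    lem = ℚS.solve 6 (λ s t a b y w → (s ℚS.:* a) ℚS.:* y ℚS.:+ w ℚS.:* (t ℚS.:* b)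
      ℚS.:= s ℚS.:* (a ℚS.:* y) ℚS.:+ t ℚS.:* (b ℚS.:* w)) refl
    expand : ∀ i y → G p q (σ * r i) y ≡ σ ^ p * (r i ^ p * y ^ q) + σ ^ q * (r i ^ q * y ^ p)
    expand i y = trans
      (cong₂ (λ a b → a * y ^ q + y ^ p * b) (^-distrib-* σ (r i) p) (^-distrib-* σ (r i) q))
      (lem (σ ^ p) (σ ^ q) (r i ^ p) (r i ^ q) (y ^ q) (y ^ p))

  -- Since 2m - n = 2(m - n) + n, the unequal pairs for a fixed m are the terms of the double series
  -- on one antidiagonal, and m ≤ N sweeps out the triangle. The equal pairs give the partial sum of
  -- ζ(p + q).
  ∑-inner : ∀ p q N → ∑ N (inner p q) ≡ T p q N + T q p N + H (p ℕ.+ q) N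
  ∑-inner p q N = begin
    ∑ N (inner p q)
      ≡⟨ ∑-cong N (λ M → cong₂ _+_
           (trans (∑-cong< M (λ i i<M → expand M i i<M))
             (∑-distrib-+ M (λ i → f p q (M ∸ suc i) i) (λ i → f q p (M ∸ suc i) i)))
           (sym (^-homo-* (r M) p q))) ⟩
    ∑[ M < N ] (t p q M + t q p M) + r M ^ (p ℕ.+ q)
      ≡⟨ ∑-distrib-+ N (λ M → t p q M + t q p M) (λ M → r M ^ (p ℕ.+ q)) ⟩
    (∑[ M < N ] t p q M + t q p M) + H (p ℕ.+ q) N
      ≡⟨ cong (_+ H (p ℕ.+ q) N) (∑-distrib-+ N (t p q) (t q p)) ⟩
    ∑ N (t p q) + ∑ N (t q p) + H (p ℕ.+ q) N
      ≡⟨ cong₂ (λ a b → a + b + H (p ℕ.+ q) N)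
           (∑-triangle N (λ i j → f p q j i)) (∑-triangle N (λ i j → f q p j i)) ⟩
    T p q N + T q p N + H (p ℕ.+ q) N ∎
    where
    t : ℕ → ℕ → ℕ → ℚ
    t p q M = ∑[ i < M ] f p q (M ∸ suc i) i
    denominator : ∀ M i → i ℕ.< M → M ℕ.+ (M ∸ i) ≡ suc (c (M ∸ suc i)) ℕ.+ i
    denominator M i i<M = begin
      M ℕ.+ (M ∸ i)                ≡⟨ cong₂ ℕ._+_ (sym (ℕ.m∸n+n≡m i<M)) (ℕ.+-∸-assoc 1 i<M) ⟩
      d ℕ.+ suc i ℕ.+ suc d        ≡⟨ cong (ℕ._+ suc d) (ℕ.+-suc d i) ⟩
      suc (d ℕ.+ i) ℕ.+ suc d      ≡⟨ cong suc (ℕ.+-assoc d i (suc d)) ⟩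
      suc (d ℕ.+ (i ℕ.+ suc d))    ≡⟨ cong (λ k → suc (d ℕ.+ k)) (ℕ.+-comm i (suc d)) ⟩
      suc (d ℕ.+ (suc d ℕ.+ i))    ≡⟨ cong suc (ℕ.+-assoc d (suc d) i) ⟨
      suc (c d) ℕ.+ i              ∎
      where d = M ∸ suc i
    expand : ∀ M i → i ℕ.< M → G p q (r i) (r (M ℕ.+ (M ∸ i))) ≡ f p q (M ∸ suc i) i + f q p (M ∸ suc i) i
    expand M i i<M = trans (cong (λ n → G p q (r i) (r n)) (denominator M i i<M))
      (cong (f p q (M ∸ suc i) i +_) (*-comm (r (suc (c (M ∸ suc i)) ℕ.+ i) ^ p) (r i ^ q)))

  D E W : ℕ → ℕ → ℕ → ℚ
  D P Q N = ∑[ M < N ] diagonal-coefficient P Q (r (c M))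
  W P Q N = ∑[ M < N ] R P Q (r (c M)) (h N)
  E P Q N = ∑[ M < N ] R P Q (r (c M)) (e N M)

  -- Outer pairs give `σ ^ p * S` and inner pairs `T`, that is `S` less `U`: hence the factor
  -- `1ℚ + σ ^ p` and the error `U`. `W P Q` is grouped with `D Q P`, whose binomial has the lower
  -- index q - 1 of the first sum in the theorem.
  truncated-identity : ∀ P Q N → let p = suc P ; q = suc Q in
    (1ℚ + σ ^ p) * S p q N + (1ℚ + σ ^ q) * S q p N
      - ((W P Q N - D Q P N) + (W Q P N - D P Q N) - H (p ℕ.+ q) N)
    ≡ (U p q N + U q p N) + (E P Q N + E Q P N)
  truncated-identity P Q N = begin
    (1ℚ + a) * s + (1ℚ + b) * s′ - ((w - d′) + (w′ - d) - η)
      ≡⟨ cong₂ (λ x y → (1ℚ + a) * x + (1ℚ + b) * y - ((w - d′) + (w′ - d) - η))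
           (S≡T+U p q N) (S≡T+U q p N) ⟩
    (1ℚ + a) * (t + u) + (1ℚ + b) * (t′ + u′) - ((w - d′) + (w′ - d) - η)
      ≡⟨ lem₁ a b t u t′ u′ w d w′ d′ η ⟩
    ((a * (t + u) + b * (t′ + u′)) + (t + t′ + η) + (d + d′)) + ((u + u′) - (w + w′))
      ≡⟨ cong (_+ ((u + u′) - (w + w′))) (cong (λ x → x + (t + t′ + η) + (d + d′))
           (cong₂ (λ x y → a * x + b * y) (S≡T+U p q N) (S≡T+U q p N))) ⟨
    ((a * s + b * s′) + (t + t′ + η) + (d + d′)) + ((u + u′) - (w + w′))
      ≡⟨ cong (_+ ((u + u′) - (w + w′))) summed ⟩
    ((w + w′) + (ε + ε′)) + ((u + u′) - (w + w′))
      ≡⟨ lem₂ (w + w′) (ε + ε′) (u + u′) ⟩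
    (u + u′) + (ε + ε′) ∎
    where
    p = suc P
    q = suc Q
    a = σ ^ p
    b = σ ^ q
    s = S p q N
    s′ = S q p N
    t = T p q N
    t′ = T q p N
    u = U p q N
    u′ = U q p N
    w = W P Q N
    w′ = W Q P N
    d = D P Q N
    d′ = D Q P N
    ε = E P Q N
    ε′ = E Q P N
    η = H (p ℕ.+ q) N
    lem₁ : ∀ a b t u t′ u′ w d w′ d′ η →
      (1ℚ + a) * (t + u) + (1ℚ + b) * (t′ + u′) - ((w - d′) + (w′ - d) - η)
      ≡ ((a * (t + u) + b * (t′ + u′)) + (t + t′ + η) + (d + d′)) + ((u + u′) - (w + w′))
    lem₁ = ℚS.solve 11
      (λ a b t u t′ u′ w d w′ d′ η →
        (ℚS.con 1ℚ ℚS.:+ a) ℚS.:* (t ℚS.:+ u) ℚS.:+ (ℚS.con 1ℚ ℚS.:+ b) ℚS.:* (t′ ℚS.:+ u′)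
          ℚS.:- ((w ℚS.:- d′) ℚS.:+ (w′ ℚS.:- d) ℚS.:- η)
        ℚS.:= ((a ℚS.:* (t ℚS.:+ u) ℚS.:+ b ℚS.:* (t′ ℚS.:+ u′)) ℚS.:+ (t ℚS.:+ t′ ℚS.:+ η)
          ℚS.:+ (d ℚS.:+ d′)) ℚS.:+ ((u ℚS.:+ u′) ℚS.:- (w ℚS.:+ w′)))
      refl
    lem₂ : ∀ w ε u → (w + ε) + (u - w) ≡ u + ε
    lem₂ = ℚS.solve 3 (λ w ε u → (w ℚS.:+ ε) ℚS.:+ (u ℚS.:- w) ℚS.:= u ℚS.:+ ε) refl
    z : ℕ → ℚ
    z M = r (c M)
    summed : (a * s + b * s′) + (t + t′ + η) + (d + d′) ≡ (w + w′) + (ε + ε′)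
    summed = begin
      (a * s + b * s′) + (t + t′ + η) + (d + d′)
        ≡⟨ cong₂ _+_ (cong₂ _+_ (∑-outer p q N) (∑-inner p q N))
             (∑-distrib-+ N (λ M → diagonal-coefficient P Q (z M)) (λ M → diagonal-coefficient Q P (z M))) ⟨
      (∑ N (outer p q N) + ∑ N (inner p q)) + ∑ N δ
        ≡⟨ cong (_+ ∑ N δ) (∑-distrib-+ N (outer p q N) (inner p q)) ⟨
      (∑[ M < N ] outer p q N M + inner p q M) + ∑ N δ
        ≡⟨ ∑-distrib-+ N (λ M → outer p q N M + inner p q M) δ ⟨
      ∑[ M < N ] (outer p q N M + inner p q M) + δ M
        ≡⟨ ∑-cong N (level-identity P Q N) ⟩
      ∑[ M < N ] L P Q (z M) (h N) + L P Q (z M) (e N M)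
        ≡⟨ ∑-distrib-+ N (λ M → L P Q (z M) (h N)) (λ M → L P Q (z M) (e N M)) ⟩
      (∑[ M < N ] L P Q (z M) (h N)) + (∑[ M < N ] L P Q (z M) (e N M))
        ≡⟨ cong₂ _+_
             (∑-distrib-+ N (λ M → R P Q (z M) (h N)) (λ M → R Q P (z M) (h N)))
             (∑-distrib-+ N (λ M → R P Q (z M) (e N M)) (λ M → R Q P (z M) (e N M))) ⟩
      (w + w′) + (ε + E Q P N) ∎
      where
      δ : ℕ → ℚ
      δ M = diagonal-coefficient P Q (z M) + diagonal-coefficient Q P (z M)

-- Error bounds of order 1/N

module ErrorBounds where
  import Data.Integer.Base as ℤ
  open import Data.Nat.Base as ℕ using (ℕ; zero; suc; _∸_; z≤n; s≤s)
  import Data.Nat.Properties as ℕ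
  open import Data.Nat.Combinatorics using (_C_)
  open import Data.Product.Base using (_,_)
  open import Data.Rational.Base
  open import Data.Rational.Properties
  open import Relation.Binary.PropositionalEquality
  open ≤-Reasoning
  open Sums
  open PartialFractions
  open TruncatedIdentity

  0≤r : ∀ n → 0ℚ ≤ r n
  0≤r n = nonNegative⁻¹ _ {{normalize-nonNeg 1 (suc n)}}

  r-anti : ∀ {m n} → m ℕ.≤ n → r n ≤ r m
  r-anti {m} {n} m≤n = 1/-anti (suc m) (suc n) (s≤s m≤n)

  r≤1 : ∀ n → r n ≤ 1ℚ
  r≤1 n = r-anti {0} {n} z≤n

  0≤κ : ∀ n → 0ℚ ≤ κ n
  0≤κ n = nonNegative⁻¹ _ {{normalize-nonNeg n 1}}

  0≤* : ∀ {x y} → 0ℚ ≤ x → 0ℚ ≤ y → 0ℚ ≤ x * y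
  0≤* {x} {y} 0≤x 0≤y = *-mono-≤-nonNeg {0ℚ} {x} {0ℚ} {y} ≤-refl 0≤x 0≤x 0≤y

  *-monoʳ : ∀ {x y} z → 0ℚ ≤ z → x ≤ y → x * z ≤ y * z
  *-monoʳ z 0≤z = *-monoʳ-≤-nonNeg z {{nonNegative 0≤z}}

  *-monoˡ : ∀ {x y} z → 0ℚ ≤ z → x ≤ y → z * x ≤ z * y
  *-monoˡ z 0≤z = *-monoˡ-≤-nonNeg z {{nonNegative 0≤z}}

  0≤^ : ∀ {x} n → 0ℚ ≤ x → 0ℚ ≤ x ^ n
  0≤^ zero    0≤x = nonNegative⁻¹ 1ℚ
  0≤^ (suc n) 0≤x = 0≤* 0≤x (0≤^ n 0≤x)

  ^-mono : ∀ {x y} n → 0ℚ ≤ x → x ≤ y → x ^ n ≤ y ^ n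
  ^-mono zero    0≤x x≤y = ≤-refl
  ^-mono (suc n) 0≤x x≤y =
    *-mono-≤-nonNeg (0≤^ n 0≤x) (≤-trans 0≤x x≤y) x≤y (^-mono n 0≤x x≤y)

  ^-anti : ∀ {x m n} → 0ℚ ≤ x → x ≤ 1ℚ → m ℕ.≤ n → x ^ n ≤ x ^ m
  ^-anti {x} {n = zero}  0≤x x≤1 z≤n       = ≤-refl
  ^-anti {x} {n = suc n} 0≤x x≤1 z≤n       = begin
    x * x ^ n ≤⟨ *-mono-≤-nonNeg (0≤^ n 0≤x) (nonNegative⁻¹ 1ℚ) x≤1 (^-anti {x} {0} {n} 0≤x x≤1 z≤n) ⟩
    1ℚ        ∎
  ^-anti {x} {suc m} {suc n} 0≤x x≤1 (s≤s m≤n) = *-monoˡ x 0≤x (^-anti {x} {m} {n} 0≤x x≤1 m≤n)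

  double : ℚ → ℚ
  double x = x + x

  0≤double : ∀ {x} → 0ℚ ≤ x → 0ℚ ≤ double x
  0≤double 0≤x = +-mono-≤ 0≤x 0≤x

  0≤+ : ∀ {x y} → 0ℚ ≤ x → 0ℚ ≤ y → 0ℚ ≤ x + y
  0≤+ 0≤x 0≤y = +-mono-≤ 0≤x 0≤y

  square-telescopes : ∀ k → r k ^ 2 + double (r (suc k)) ≤ double (r k)
  square-telescopes k = begin
    r k ^ 2 + double b                      ≡⟨ cong (_+ double b) square ⟨
    s + double b                            ≤⟨ +-monoˡ-≤ (double b) (r-double k) ⟩
    ((r k - b) + (r k - b)) + double b      ≡⟨ lem (r k) b ⟩
    double (r k)                            ∎
    where
    b = r (suc k)
    s = ℤ.+ 1 / (suc k ℕ.* suc k)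
    square : s ≡ r k ^ 2
    square = trans (1/-* (suc k) (suc k)) (cong (r k *_) (sym (*-identityʳ (r k))))
    lem : ∀ a b → ((a - b) + (a - b)) + (b + b) ≡ a + a
    lem = ℚS.solve 2 (λ a b → ((a ℚS.:- b) ℚS.:+ (a ℚS.:- b)) ℚS.:+ (b ℚS.:+ b) ℚS.:= a ℚS.:+ a) refl

  inverse-square-tail : ∀ N n → (∑[ i < n ] r (N ℕ.+ i) ^ 2) ≤ double (r N)
  inverse-square-tail N n = ≤-trans (x≤x+y _ (0≤double (0≤r (N ℕ.+ n)))) (go n)
    where
    -- The remainder `double (r (N ℕ.+ n))` is kept on the left so that the induction telescopes.
    go : ∀ n → (∑[ i < n ] r (N ℕ.+ i) ^ 2) + double (r (N ℕ.+ n)) ≤ double (r N)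
    go zero    = ≤-reflexive (trans (+-identityˡ _) (cong (λ k → double (r k)) (ℕ.+-identityʳ N)))
    go (suc n) = begin
      ∑ (suc n) g + double (r (N ℕ.+ suc n))
        ≡⟨ cong₂ _+_ (∑-last n g) (cong (λ k → double (r k)) (ℕ.+-suc N n)) ⟩
      ∑ n g + g n + double (r (suc (N ℕ.+ n)))
        ≡⟨ +-assoc (∑ n g) (g n) _ ⟩
      ∑ n g + (g n + double (r (suc (N ℕ.+ n))))
        ≤⟨ +-monoʳ-≤ (∑ n g) (square-telescopes (N ℕ.+ n)) ⟩
      ∑ n g + double (r (N ℕ.+ n))
        ≤⟨ go n ⟩
      double (r N) ∎
      where
      g : ℕ → ℚ
      g i = r (N ℕ.+ i) ^ 2

  ∑-const : ∀ n x → (∑[ i < n ] x) ≡ κ n * x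
  ∑-const zero    x = sym (*-zeroˡ x)
  ∑-const (suc n) x = begin-equality
    x + (∑[ i < n ] x)   ≡⟨ cong (x +_) (∑-const n x) ⟩
    x + κ n * x          ≡⟨ cong (_+ κ n * x) (*-identityˡ x) ⟨
    1ℚ * x + κ n * x     ≡⟨ *-distribʳ-+ x 1ℚ (κ n) ⟨
    (1ℚ + κ n) * x       ≡⟨ cong (_* x) (κ-+ 1 n) ⟨
    κ (suc n) * x        ∎

  f-nonNeg : ∀ p q j i → 0ℚ ≤ f p q j i
  f-nonNeg p q j i = 0≤* (0≤^ p (0≤r i)) (0≤^ q (0≤r (suc (c j) ℕ.+ i)))

  U-nonNeg : ∀ p q N → 0ℚ ≤ U p q N
  U-nonNeg p q N = ∑-nonNeg N λ i → ∑-nonNeg (suc i) λ l → f-nonNeg p q (N ∸ suc i ℕ.+ l) i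

  -- For fixed n, the terms beyond the triangle have denominators 2m + n > N + l with l = 0, 1, ...,
  -- so the sum over m is at most a tail of `∑ k⁻²`. The sum over n costs only the bounded factor
  -- `∑ n⁻²`.
  U-bound : ∀ p q N → 2 ℕ.≤ p → 2 ℕ.≤ q → U p q N ≤ double (r 0) * double (r N)
  U-bound p q N 2≤p 2≤q = begin
    U p q N
      ≤⟨ ∑-mono N (λ i → ∑-mono (suc i) (λ l → summand i l)) ⟩
    ∑[ i < N ] ∑[ l < suc i ] r i ^ 2 * r (N ℕ.+ l) ^ 2
      ≡⟨ ∑-cong N (λ i → ∑-*ˡ (suc i) (r i ^ 2) (λ l → r (N ℕ.+ l) ^ 2)) ⟩
    ∑[ i < N ] r i ^ 2 * (∑[ l < suc i ] r (N ℕ.+ l) ^ 2)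
      ≤⟨ ∑-mono N (λ i → *-monoˡ (r i ^ 2) (0≤^ 2 (0≤r i)) (inverse-square-tail N (suc i))) ⟩
    ∑[ i < N ] r i ^ 2 * double (r N)
      ≡⟨ ∑-*ʳ N (double (r N)) (λ i → r i ^ 2) ⟩
    (∑[ i < N ] r i ^ 2) * double (r N)
      ≤⟨ *-monoʳ (double (r N)) (0≤double (0≤r N)) (inverse-square-tail 0 N) ⟩
    double (r 0) * double (r N) ∎
    where
    denominator : ∀ i l → N ℕ.+ l ℕ.≤ suc (c (N ∸ suc i ℕ.+ l)) ℕ.+ i
    denominator i l = ℕ.≤-trans
      (ℕ.+-monoˡ-≤ l (ℕ.m≤n+m∸n N (suc i)))
      (ℕ.≤-trans (ℕ.≤-reflexive (trans (ℕ.+-assoc (suc i) (N ∸ suc i) l) (cong suc (ℕ.+-comm i j))))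
        (ℕ.+-monoˡ-≤ i (s≤s (ℕ.m≤m+n j (suc j)))))
      where j = N ∸ suc i ℕ.+ l
    summand : ∀ i l → f p q (N ∸ suc i ℕ.+ l) i ≤ r i ^ 2 * r (N ℕ.+ l) ^ 2
    summand i l = *-mono-≤-nonNeg (0≤^ q (0≤r k)) (0≤^ 2 (0≤r i))
      (^-anti (0≤r i) (r≤1 i) 2≤p)
      (≤-trans (^-anti (0≤r k) (r≤1 k) 2≤q) (^-mono 2 (0≤r k) (r-anti (denominator i l))))
      where k = suc (c (N ∸ suc i ℕ.+ l)) ℕ.+ i

  e-nonNeg : ∀ N M k → 0ℚ ≤ e N M k
  e-nonNeg N M k = ∑-nonNeg (suc (c M)) λ i → 0≤^ k (0≤r (N ℕ.+ i))

  -- For k ≥ 2 the block lies in a convergent tail, and two factors 1/(2m) give summability over m.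
  -- For k = 1 it is bounded by its length 2m times 1/(N + 1); then a ≥ 3, so one factor cancels the
  -- length and two are left.
  e-bound : ∀ N M a k → 2 ℕ.≤ a → 1 ℕ.≤ k → 4 ℕ.≤ a ℕ.+ k →
    r (c M) ^ a * e N M k ≤ r M ^ 2 * double (r N)
  e-bound N M a (suc (suc k)) 2≤a _ _ = *-mono-≤-nonNeg (e-nonNeg N M (suc (suc k))) (0≤^ 2 (0≤r M))
    (≤-trans (^-anti (0≤r (c M)) (r≤1 (c M)) 2≤a) (^-mono 2 (0≤r (c M)) (r-anti (ℕ.m≤m+n M (suc M)))))
    (≤-trans
      (∑-mono (suc (c M)) λ i → ^-anti {r (N ℕ.+ i)} {2} {suc (suc k)} (0≤r (N ℕ.+ i)) (r≤1 (N ℕ.+ i)) (s≤s (s≤s z≤n)))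
      (inverse-square-tail N (suc (c M))))
  e-bound N M a 1 _ _ 4≤a+1 = begin
    z ^ a * e N M 1
      ≤⟨ *-mono-≤-nonNeg (e-nonNeg N M 1) (0≤^ 3 0≤z) (^-anti 0≤z (r≤1 (c M)) 3≤a) e≤ ⟩
    z ^ 3 * (κ (suc (c M)) * r N)
      ≡⟨ lem z (κ (suc (c M))) (r N) ⟩
    (z * κ (suc (c M))) * (z ^ 2 * r N)
      ≡⟨ cong (_* (z ^ 2 * r N)) (r-inverse (c M)) ⟩
    1ℚ * (z ^ 2 * r N)
      ≡⟨ *-identityˡ _ ⟩
    z ^ 2 * r N
      ≤⟨ *-mono-≤-nonNeg (0≤r N) (0≤^ 2 (0≤r M))
           (^-mono 2 0≤z (r-anti (ℕ.m≤m+n M (suc M)))) (x≤x+y (r N) (0≤r N)) ⟩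
    r M ^ 2 * double (r N) ∎
    where
    z = r (c M)
    0≤z = 0≤r (c M)
    3≤a : 3 ℕ.≤ a
    3≤a = ℕ.≤-pred (subst (4 ℕ.≤_) (ℕ.+-comm a 1) 4≤a+1)
    e≤ : e N M 1 ≤ κ (suc (c M)) * r N
    e≤ = ≤-trans
      (∑-mono (suc (c M)) λ i → ≤-trans (≤-reflexive (*-identityʳ (r (N ℕ.+ i)))) (r-anti (ℕ.m≤m+n N i)))
      (≤-reflexive (∑-const (suc (c M)) (r N)))
    lem : ∀ z k x → (z * (z * (z * 1ℚ))) * (k * x) ≡ (z * k) * ((z * (z * 1ℚ)) * x)
    lem = ℚS.solve 3 (λ z k x → let 1′ = ℚS.con 1ℚ in
      (z ℚS.:* (z ℚS.:* (z ℚS.:* 1′))) ℚS.:* (k ℚS.:* x)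
        ℚS.:= (z ℚS.:* k) ℚS.:* ((z ℚS.:* (z ℚS.:* 1′)) ℚS.:* x)) refl

  E-nonNeg : ∀ P Q N → 0ℚ ≤ E P Q N
  E-nonNeg P Q N = ∑-nonNeg N λ M → ∑-nonNeg (suc P) λ l →
    0≤* (0≤* (0≤κ ((l ℕ.+ Q) C Q)) (0≤^ (l ℕ.+ suc Q) (0≤r (c M)))) (e-nonNeg N M (suc (P ∸ l)))

  E-constant : ℕ → ℕ → ℚ
  E-constant P Q = (∑[ l < suc P ] κ ((l ℕ.+ Q) C Q)) * double (r 0)

  0≤E-constant : ∀ P Q → 0ℚ ≤ E-constant P Q
  0≤E-constant P Q = 0≤* (∑-nonNeg (suc P) λ l → 0≤κ ((l ℕ.+ Q) C Q)) (0≤double (0≤r 0))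

  E-bound : ∀ P Q N → 1 ℕ.≤ P → 1 ℕ.≤ Q → E P Q N ≤ E-constant P Q * double (r N)
  E-bound P Q N 1≤P 1≤Q = begin
    E P Q N
      ≤⟨ ∑-mono N level ⟩
    ∑[ M < N ] k * (r M ^ 2 * double (r N))
      ≡⟨ ∑-*ˡ N k (λ M → r M ^ 2 * double (r N)) ⟩
    k * (∑[ M < N ] r M ^ 2 * double (r N))
      ≡⟨ cong (k *_) (∑-*ʳ N (double (r N)) (λ M → r M ^ 2)) ⟩
    k * ((∑[ M < N ] r M ^ 2) * double (r N))
      ≡⟨ *-assoc k (∑[ M < N ] r M ^ 2) (double (r N)) ⟨
    k * (∑[ M < N ] r M ^ 2) * double (r N)
      ≤⟨ *-monoʳ (double (r N)) (0≤double (0≤r N))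
           (*-monoˡ k (∑-nonNeg (suc P) (λ l → 0≤κ ((l ℕ.+ Q) C Q))) (inverse-square-tail 0 N)) ⟩
    E-constant P Q * double (r N) ∎
    where
    k = ∑[ l < suc P ] κ ((l ℕ.+ Q) C Q)
    -- `∑-mono` asks for all `l`; beyond `P` the truncated difference only raises the total above p
    -- + q.
    exponents : ∀ l → 4 ℕ.≤ l ℕ.+ suc Q ℕ.+ suc (P ∸ l)
    exponents l = ℕ.≤-trans
      (ℕ.+-mono-≤ (s≤s 1≤Q) (s≤s (ℕ.≤-trans 1≤P (ℕ.m≤n+m∸n P l))))
      (ℕ.≤-reflexive (trans (cong (suc Q ℕ.+_) (sym (ℕ.+-suc l (P ∸ l))))
        (trans (sym (ℕ.+-assoc (suc Q) l (suc (P ∸ l)))) (cong (ℕ._+ suc (P ∸ l)) (ℕ.+-comm (suc Q) l)))))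
    level : ∀ M → R P Q (r (c M)) (e N M) ≤ k * (r M ^ 2 * double (r N))
    level M = ≤-trans
      (∑-mono (suc P) λ l → ≤-trans
        (≤-reflexive (*-assoc (κ ((l ℕ.+ Q) C Q)) (r (c M) ^ (l ℕ.+ suc Q)) (e N M (suc (P ∸ l)))))
        (*-monoˡ (κ ((l ℕ.+ Q) C Q)) (0≤κ ((l ℕ.+ Q) C Q))
          (e-bound N M (l ℕ.+ suc Q) (suc (P ∸ l)) (ℕ.≤-trans (s≤s 1≤Q) (ℕ.m≤n+m (suc Q) l)) (s≤s z≤n) (exponents l))))
      (≤-reflexive (∑-*ʳ (suc P) (r M ^ 2 * double (r N)) (λ l → κ ((l ℕ.+ Q) C Q))))

  ≈ᴿ-from-bound : ∀ x y K → 0ℚ < K →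
    (∀ N → 0ℚ ≤ seq x N - seq y N) → (∀ N → seq x N - seq y N ≤ K * double (r N)) → x ≈ᴿ y
  ≈ᴿ-from-bound x y K 0<K lower upper ε 0<ε =
    -- The factor 2 in `double (r N)` is moved to the constant, so `r N` has to fall below ε/(2K).
    let δ , 0<δ , 2Kδ≡ε = scale (double K) ε 0<2K 0<ε
        n , rn<δ        = r-archimedean δ 0<δ
    in n , λ N n≤N → begin-strict
    ∣ seq x N - seq y N ∣ ≡⟨ 0≤p⇒∣p∣≡p (lower N) ⟩
    seq x N - seq y N     ≤⟨ upper N ⟩
    K * double (r N)      ≡⟨ lem K (r N) ⟩
    double K * r N        <⟨ *-monoʳ-<-pos (double K) {{positive 0<2K}} (≤-<-trans (r-anti n≤N) rn<δ) ⟩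
    double K * δ          ≡⟨ 2Kδ≡ε ⟩
    ε                     ∎
    where
    0<2K : 0ℚ < double K
    0<2K = +-mono-< 0<K 0<K
    lem : ∀ k x → k * (x + x) ≡ (k + k) * x
    lem = ℚS.solve 2 (λ k x → k ℚS.:* (x ℚS.:+ x) ℚS.:= (k ℚS.:+ k) ℚS.:* x) refl

-- Identification with the zeta values of the theorem

module MainTerms where
  open import Data.Integer.Base as ℤ using (1ℤ; -1ℤ)
  open import Data.Nat.Base as ℕ using (ℕ; zero; suc; _∸_; z≤n; s≤s; ⌊_/2⌋)
  import Data.Nat.Properties as ℕ
  open import Data.Nat.Combinatorics using (_C_)
  open import Data.Product.Base using (_×_; _,_)
  open import Data.Rational.Base
  open import Data.Rational.Properties
  open import Data.Sum.Base using (_⊎_; inj₁; inj₂)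
  open import Relation.Binary.PropositionalEquality
  open ≡-Reasoning
  open Sums
  open PartialFractions
  open TruncatedIdentity

  seq-ζ : ∀ s N → 2 ℕ.≤ s → seq (ζ s) N ≡ H s N
  seq-ζ (suc zero)      N (s≤s ())
  seq-ζ s@(suc (suc _)) N _        = ∑-cong N λ i → ^-≡^ (suc i) s

  σ-even : ∀ j → σ ^ (2 ℕ.* j) ≡ 1ℚ
  σ-even zero    = refl
  σ-even (suc j) = begin
    σ ^ (2 ℕ.* suc j)        ≡⟨ cong (σ ^_) (ℕ.*-suc 2 j) ⟩
    σ * (σ * σ ^ (2 ℕ.* j))  ≡⟨ cong (λ x → σ * (σ * x)) (σ-even j) ⟩
    1ℚ                       ∎

  σ-sign : ∀ n → (1ℤ ℤ.+ -1ℤ ℤ.^ n) / 1 ≡ 1ℚ + σ ^ n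
  σ-sign n with signs n
    where
    signs : ∀ n → (-1ℤ ℤ.^ n ≡ 1ℤ × σ ^ n ≡ 1ℚ) ⊎ (-1ℤ ℤ.^ n ≡ -1ℤ × σ ^ n ≡ σ)
    signs zero    = inj₁ (refl , refl)
    signs (suc n) with signs n
    ... | inj₁ (a , b) = inj₂ (cong (-1ℤ ℤ.*_) a , cong (σ *_) b)
    ... | inj₂ (a , b) = inj₁ (cong (-1ℤ ℤ.*_) a , cong (σ *_) b)
  ... | inj₁ (a , b) = trans (cong (λ i → (1ℤ ℤ.+ i) / 1) a) (cong (1ℚ +_) (sym b))
  ... | inj₂ (a , b) = trans (cong (λ i → (1ℤ ℤ.+ i) / 1) a) (cong (1ℚ +_) (sym b))

  -- ψ N k is the N-th approximation of (1 + (-1)ᵏ) ζ(k), with ζ(0) = -1/2.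
  ψ : ℕ → ℕ → ℚ
  ψ N zero    = - 1ℚ
  ψ N (suc k) = h N (suc k)

  ψ-even : ∀ N j → κ 2 * seq (ζ (2 ℕ.* j)) N ≡ ψ N (2 ℕ.* j)
  ψ-even N zero    = refl
  ψ-even N (suc j) = cong₂ _*_ (cong (1ℚ +_) (sym (σ-even (suc j))))
    (seq-ζ (2 ℕ.* suc j) N (ℕ.*-monoʳ-≤ 2 (s≤s z≤n)))

  ψ-odd : ∀ N j → ψ N (suc (2 ℕ.* j)) ≡ 0ℚ
  ψ-odd N j = trans (cong (λ x → (1ℚ + σ * x) * H (suc (2 ℕ.* j)) N) (σ-even j))
    (*-zeroˡ (H (suc (2 ℕ.* j)) N))

  -- The origin of the powers of 2 in the theorem: partial fractions produce powers of 1/(2m).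
  half-powers : ∀ s N → 2 ^- s * H s N ≡ ∑[ M < N ] r (c M) ^ s
  half-powers s N = begin
    2 ^- s * H s N                       ≡⟨ cong (_* H s N) (^-≡^ 2 s) ⟩
    ½ ^ s * H s N                        ≡⟨ ∑-*ˡ N (½ ^ s) (λ M → r M ^ s) ⟨
    ∑[ M < N ] ½ ^ s * r M ^ s           ≡⟨ ∑-cong N (λ M → ^-distrib-* ½ (r M) s) ⟨
    ∑[ M < N ] (½ * r M) ^ s             ≡⟨ ∑-cong N (λ M → cong (_^ s) (½*r M)) ⟩
    ∑[ M < N ] r (c M) ^ s               ∎
    where
    ½*r : ∀ M → ½ * r M ≡ r (c M)
    ½*r M = trans (sym (1/-* 2 (suc M))) (cong (λ n → r (M ℕ.+ n)) (ℕ.*-identityˡ (suc M)))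

  summand : ℕ → ℕ → ℕ → ℕ → ℚ
  summand k w N j = 2 ^- (w ∸ 2 ℕ.* j) * κ ((w ∸ 1 ∸ 2 ℕ.* j) C k)
                      * seq (ζ (2 ℕ.* j)) N * seq (ζ (w ∸ 2 ℕ.* j)) N

  -- Twice `summand`, extended to odd exponents so that it can be matched with the terms of `R` one
  -- by one.
  main-term : ℕ → ℕ → ℕ → ℕ → ℚ
  main-term Q w N k = κ ((w ∸ 1 ∸ k) C Q) * ψ N k * (∑[ M < N ] r (c M) ^ (w ∸ k))

  -- The hypothesis keeps the second zeta argument at 2 or above, away from the dummy value at 1.
  summand≡main-term : ∀ Q w N j → 2 ℕ.+ 2 ℕ.* j ℕ.≤ w →
    κ 2 * summand Q w N j ≡ main-term Q w N (2 ℕ.* j)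
  summand≡main-term Q w N j 2+2j≤w = begin
    κ 2 * (x * k * y * seq (ζ (w ∸ 2 ℕ.* j)) N)
      ≡⟨ cong (λ t → κ 2 * (x * k * y * t)) (seq-ζ (w ∸ 2 ℕ.* j) N (ℕ.m+n≤o⇒m≤o∸n 2 2+2j≤w)) ⟩
    κ 2 * (x * k * y * H (w ∸ 2 ℕ.* j) N)
      ≡⟨ lem (κ 2) x k y (H (w ∸ 2 ℕ.* j) N) ⟩
    k * (κ 2 * y) * (x * H (w ∸ 2 ℕ.* j) N)
      ≡⟨ cong₂ (λ a b → k * a * b) (ψ-even N j) (half-powers (w ∸ 2 ℕ.* j) N) ⟩
    main-term Q w N (2 ℕ.* j) ∎
    where
    x = 2 ^- (w ∸ 2 ℕ.* j)
    k = κ ((w ∸ 1 ∸ 2 ℕ.* j) C Q)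
    y = seq (ζ (2 ℕ.* j)) N
    lem : ∀ a x k y h → a * (x * k * y * h) ≡ k * (a * y) * (x * h)
    lem = ℚS.solve 5 (λ a x k y h → a ℚS.:* (x ℚS.:* k ℚS.:* y ℚS.:* h)
      ℚS.:= k ℚS.:* (a ℚS.:* y) ℚS.:* (x ℚS.:* h)) refl

  main-term-odd : ∀ Q w N j → main-term Q w N (suc (2 ℕ.* j)) ≡ 0ℚ
  main-term-odd Q w N j = trans
    (cong (λ x → a * x * b) (ψ-odd N j))
    (trans (cong (_* b) (*-zeroʳ a)) (*-zeroˡ b))
    where
    a = κ ((w ∸ 1 ∸ suc (2 ℕ.* j)) C Q)
    b = ∑[ M < N ] r (c M) ^ (w ∸ suc (2 ℕ.* j))

  -- Here 2 ζ(0) = -1 turns the sum over the excluded entries 2m, moved across the equation, into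
  -- the term j = 0.
  main-term-zero : ∀ P Q N → main-term Q (suc P ℕ.+ suc Q) N 0 ≡ - D Q P N
  main-term-zero P Q N = begin
    κ ((P ℕ.+ suc Q) C Q) * - 1ℚ * (∑[ M < N ] r (c M) ^ (suc P ℕ.+ suc Q))
      ≡⟨ cong₂ (λ a b → κ (a C Q) * - 1ℚ * (∑[ M < N ] r (c M) ^ b)) comm (ℕ.+-comm (suc P) (suc Q)) ⟩
    k * - 1ℚ * (∑[ M < N ] r (c M) ^ (suc Q ℕ.+ suc P))
      ≡⟨ lem k _ ⟩
    - (k * (∑[ M < N ] r (c M) ^ (suc Q ℕ.+ suc P)))
      ≡⟨ cong -_ (∑-*ˡ N k (λ M → r (c M) ^ (suc Q ℕ.+ suc P))) ⟨
    - D Q P N ∎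
    where
    k = κ ((Q ℕ.+ suc P) C Q)
    comm : P ℕ.+ suc Q ≡ Q ℕ.+ suc P
    comm = trans (ℕ.+-suc P Q) (ℕ.+-comm (suc P) Q)
    lem : ∀ a b → a * - 1ℚ * b ≡ - (a * b)
    lem = ℚS.solve 2 (λ a b → a ℚS.:* ℚS.con (- 1ℚ) ℚS.:* b ℚS.:= ℚS.:- (a ℚS.:* b)) refl

  -- The exponent k = i + 1 ascends on the left, while `R-term` counts l = p - k; hence the
  -- reversal.
  ∑-main-term : ∀ P Q N → (∑[ i < suc P ] main-term Q (suc P ℕ.+ suc Q) N (suc i)) ≡ W P Q N
  ∑-main-term P Q N = begin
    ∑[ i < suc P ] main-term Q (suc P ℕ.+ suc Q) N (suc i)
      ≡⟨ ∑-cong< (suc P) (λ i i<p → reindex i (ℕ.s≤s⁻¹ i<p)) ⟩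
    ∑[ i < suc P ] g (P ∸ i)
      ≡⟨ ∑-reverse (suc P) g ⟨
    ∑ (suc P) g
      ≡⟨ ∑-cong (suc P) pull ⟩
    ∑[ l < suc P ] ∑[ M < N ] R-term P Q (r (c M)) (h N) l
      ≡⟨ ∑-swap (suc P) N (λ l M → R-term P Q (r (c M)) (h N) l) ⟩
    W P Q N ∎
    where
    g : ℕ → ℚ
    g l = κ ((l ℕ.+ Q) C Q) * h N (suc (P ∸ l)) * (∑[ M < N ] r (c M) ^ (l ℕ.+ suc Q))
    reindex : ∀ i → i ℕ.≤ P → main-term Q (suc P ℕ.+ suc Q) N (suc i) ≡ g (P ∸ i)
    reindex i i≤P = trans
      (cong₂ (λ a b → κ (a C Q) * h N (suc i) * (∑[ M < N ] r (c M) ^ b))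
        (trans (cong (_∸ suc i) (ℕ.+-suc P Q)) (ℕ.+-∸-comm Q i≤P))
        (ℕ.+-∸-comm (suc Q) i≤P))
      (cong (λ a → κ ((P ∸ i ℕ.+ Q) C Q) * h N (suc a) * (∑[ M < N ] r (c M) ^ (P ∸ i ℕ.+ suc Q)))
        (sym (ℕ.m∸[m∸n]≡n i≤P)))
    lem : ∀ a b x → a * b * x ≡ a * x * b
    lem = ℚS.solve 3 (λ a b x → a ℚS.:* b ℚS.:* x ℚS.:= a ℚS.:* x ℚS.:* b) refl
    pull : ∀ l → g l ≡ ∑[ M < N ] R-term P Q (r (c M)) (h N) l
    pull l = begin
      k * x * (∑[ M < N ] r (c M) ^ s)     ≡⟨ ∑-*ˡ N (k * x) (λ M → r (c M) ^ s) ⟨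
      ∑[ M < N ] k * x * r (c M) ^ s       ≡⟨ ∑-cong N (λ M → lem k x (r (c M) ^ s)) ⟩
      ∑[ M < N ] k * r (c M) ^ s * x       ∎
      where
      k = κ ((l ℕ.+ Q) C Q)
      x = h N (suc (P ∸ l))
      s = l ℕ.+ suc Q

  2*⌊n/2⌋≤n : ∀ n → 2 ℕ.* ⌊ n /2⌋ ℕ.≤ n
  2*⌊n/2⌋≤n n = ℕ.≤-trans
    (ℕ.+-monoʳ-≤ ⌊ n /2⌋ (ℕ.≤-trans (ℕ.≤-reflexive (ℕ.+-identityʳ ⌊ n /2⌋)) (ℕ.⌊n/2⌋≤⌈n/2⌉ n)))
    (ℕ.≤-reflexive (ℕ.⌊n/2⌋+⌈n/2⌉≡n n))

  -- The second sum of the theorem is the first with `P` and `Q` exchanged, yet both are written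
  -- with p + q in this order; `w` and its equation absorb the difference.
  half-sum : ∀ P Q w k (f : ℕ → ℝ) N → 1 ℕ.≤ Q → w ≡ suc P ℕ.+ suc Q → k ≡ Q →
    (∀ j → seq (f j) N ≡ summand k w N j) →
    seq (fromℕ 2 *ᴿ ∑ᴿ ⌊ suc P /2⌋ f) N ≡ W P Q N - D Q P N
  half-sum P Q w _ f N 1≤Q refl refl f≡ = begin
    κ 2 * seq (∑ᴿ ⌊ suc P /2⌋ f) N
      ≡⟨ cong (κ 2 *_) (trans (seq-∑ᴿ ⌊ suc P /2⌋ f N) (∑-cong (suc ⌊ suc P /2⌋) f≡)) ⟩
    κ 2 * ∑ (suc ⌊ suc P /2⌋) (summand Q w N)
      ≡⟨ ∑-*ˡ (suc ⌊ suc P /2⌋) (κ 2) (summand Q w N) ⟨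
    ∑[ j < suc ⌊ suc P /2⌋ ] κ 2 * summand Q w N j
      ≡⟨ ∑-cong< (suc ⌊ suc P /2⌋) (λ j j< → summand≡main-term Q w N j (bound j (ℕ.s≤s⁻¹ j<))) ⟩
    ∑[ j < suc ⌊ suc P /2⌋ ] main-term Q w N (2 ℕ.* j)
      ≡⟨ ∑-even (suc P) (main-term Q w N) (main-term-odd Q w N) ⟨
    main-term Q w N 0 + (∑[ i < suc P ] main-term Q w N (suc i))
      ≡⟨ cong₂ _+_ (main-term-zero P Q N) (∑-main-term P Q N) ⟩
    - D Q P N + W P Q N
      ≡⟨ +-comm (- D Q P N) (W P Q N) ⟩
    W P Q N - D Q P N ∎
    where
    bound : ∀ j → j ℕ.≤ ⌊ suc P /2⌋ → 2 ℕ.+ 2 ℕ.* j ℕ.≤ suc P ℕ.+ suc Q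
    bound j j≤ = ℕ.≤-trans
      (ℕ.+-mono-≤ (s≤s 1≤Q) (ℕ.≤-trans (ℕ.*-monoʳ-≤ 2 j≤) (2*⌊n/2⌋≤n (suc P))))
      (ℕ.≤-reflexive (ℕ.+-comm (suc Q) (suc P)))

  seq-ζ₂♯ : ∀ p q 2≤p 2≤q N → seq (ζ₂♯ p q 2≤p 2≤q) N ≡ S p q N
  seq-ζ₂♯ p q _ _ N = ∑-cong N λ M → ∑-cong N λ i → cong₂ _*_
    (^-≡^ (suc i) p)
    (trans (^-≡^ (2 ℕ.* suc M ℕ.+ suc i) q) (cong (λ n → r n ^ q) (eq M i)))
    where
    eq : ∀ M i → M ℕ.+ suc (M ℕ.+ 0) ℕ.+ suc i ≡ suc (c M) ℕ.+ i
    eq M i = trans (cong (λ n → M ℕ.+ suc n ℕ.+ suc i) (ℕ.+-identityʳ M)) (ℕ.+-suc (c M) i)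

-- Passage to the limit

open import Data.Integer.Base using (1ℤ; -1ℤ) renaming (_+_ to _+ℤ_; _^_ to _^ℤ_)
open import Data.Nat.Base using (ℕ; _+_; _*_; _∸_; _≤_; ⌊_/2⌋)
open import Data.Nat.Base using (suc; s≤s⁻¹)
import Data.Nat.Properties as ℕ
open import Data.Nat.Combinatorics using (_C_)
import Data.Rational.Base as ℚ
import Data.Rational.Properties as ℚ
open import Relation.Binary.PropositionalEquality using (_≡_; refl; sym; trans; cong₂; subst)

module _ (P Q : ℕ) (2≤p : 2 ≤ suc P) (2≤q : 2 ≤ suc Q) where
  open TruncatedIdentity
  open ErrorBounds
  open MainTerms

  error : ℕ → ℚ.ℚ
  error N = (U (suc P) (suc Q) N ℚ.+ U (suc Q) (suc P) N) ℚ.+ (E P Q N ℚ.+ E Q P N)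

  -- The constants of the two `U-bound`s and the two `E-bound`s, all multiplying `double (r N)`.
  K : ℚ.ℚ
  K = (double (r 0) ℚ.+ double (r 0)) ℚ.+ (E-constant P Q ℚ.+ E-constant Q P)

  K-positive : ℚ.0ℚ ℚ.< K
  K-positive = ℚ.+-mono-<-≤ (ℚ.positive⁻¹ (double (r 0) ℚ.+ double (r 0)))
    (0≤+ (0≤E-constant P Q) (0≤E-constant Q P))

  error-nonNeg : ∀ N → ℚ.0ℚ ℚ.≤ error N
  error-nonNeg N = 0≤+
    (0≤+ (U-nonNeg (suc P) (suc Q) N) (U-nonNeg (suc Q) (suc P) N))
    (0≤+ (E-nonNeg P Q N) (E-nonNeg Q P N))

  error-bound : ∀ N → error N ℚ.≤ K ℚ.* double (r N)
  error-bound N = ℚ.≤-trans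
    (ℚ.+-mono-≤
      (ℚ.+-mono-≤ (U-bound (suc P) (suc Q) N 2≤p 2≤q) (U-bound (suc Q) (suc P) N 2≤q 2≤p))
      (ℚ.+-mono-≤ (E-bound P Q N (s≤s⁻¹ 2≤p) (s≤s⁻¹ 2≤q)) (E-bound Q P N (s≤s⁻¹ 2≤q) (s≤s⁻¹ 2≤p))))
    (ℚ.≤-reflexive (distrib (double (r 0)) (double (r 0)) (E-constant P Q) (E-constant Q P) (double (r N))))
    where
    distrib : ∀ a b c d x → ((a ℚ.* x) ℚ.+ (b ℚ.* x)) ℚ.+ ((c ℚ.* x) ℚ.+ (d ℚ.* x))
                            ≡ ((a ℚ.+ b) ℚ.+ (c ℚ.+ d)) ℚ.* x
    distrib = ℚS.solve 5 (λ a b c d x →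
      ((a ℚS.:* x) ℚS.:+ (b ℚS.:* x)) ℚS.:+ ((c ℚS.:* x) ℚS.:+ (d ℚS.:* x))
        ℚS.:= ((a ℚS.:+ b) ℚS.:+ (c ℚS.:+ d)) ℚS.:* x) refl

  error⇒≈ᴿ : ∀ x y → (∀ N → seq x N ℚ.- seq y N ≡ error N) → x ≈ᴿ y
  error⇒≈ᴿ x y difference = ≈ᴿ-from-bound x y K K-positive
    (λ N → subst (ℚ.0ℚ ℚ.≤_) (sym (difference N)) (error-nonNeg N))
    (λ N → subst (ℚ._≤ K ℚ.* double (r N)) (sym (difference N)) (error-bound N))

theorem6p4 : (p q : ℕ) (2≤p : 2 ≤ p) (2≤q : 2 ≤ q) →
    fromℤ (1ℤ +ℤ -1ℤ ^ℤ p) *ᴿ ζ₂♯ p q 2≤p 2≤q +ᴿ fromℤ (1ℤ +ℤ -1ℤ ^ℤ q) *ᴿ ζ₂♯ q p 2≤q 2≤p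
    ≈ᴿ
    fromℕ 2 *ᴿ (∑ᴿ[ j ≤ ⌊ p /2⌋ ] fromℚ (2 ^- (p + q ∸ 2 * j)) *ᴿ fromℕ ((p + q ∸ 1 ∸ 2 * j) C (q ∸ 1)) *ᴿ ζ (2 * j) *ᴿ ζ (p + q ∸ 2 * j))
    +ᴿ fromℕ 2 *ᴿ (∑ᴿ[ j ≤ ⌊ q /2⌋ ] fromℚ (2 ^- (p + q ∸ 2 * j)) *ᴿ fromℕ ((p + q ∸ 1 ∸ 2 * j) C (p ∸ 1)) *ᴿ ζ (2 * j) *ᴿ ζ (p + q ∸ 2 * j))
    -ᴿ ζ (p + q)
theorem6p4 p@(suc P) q@(suc Q) 2≤p 2≤q =
  let
    s = λ k j → fromℚ (2 ^- (p + q ∸ 2 * j)) *ᴿ fromℕ ((p + q ∸ 1 ∸ 2 * j) C k)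
                  *ᴿ ζ (2 * j) *ᴿ ζ (p + q ∸ 2 * j)
  in error⇒≈ᴿ P Q 2≤p 2≤q
    (fromℤ (1ℤ +ℤ -1ℤ ^ℤ p) *ᴿ ζ₂♯ p q 2≤p 2≤q
      +ᴿ fromℤ (1ℤ +ℤ -1ℤ ^ℤ q) *ᴿ ζ₂♯ q p 2≤q 2≤p)
    (fromℕ 2 *ᴿ ∑ᴿ ⌊ p /2⌋ (s (q ∸ 1))
      +ᴿ fromℕ 2 *ᴿ ∑ᴿ ⌊ q /2⌋ (s (p ∸ 1)) -ᴿ ζ (p + q))
    -- The `N`-th approximations of the two sides are the two truncated expressions, so their
    -- difference is exactly `error N`.
    λ N → trans
      (cong₂ ℚ._-_
        (cong₂ ℚ._+_
          (cong₂ ℚ._*_ (σ-sign p) (seq-ζ₂♯ p q 2≤p 2≤q N))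
          (cong₂ ℚ._*_ (σ-sign q) (seq-ζ₂♯ q p 2≤q 2≤p N)))
        (cong₂ ℚ._-_
          (cong₂ ℚ._+_
            (half-sum P Q (p + q) (q ∸ 1) (s (q ∸ 1)) N (s≤s⁻¹ 2≤q) refl refl (λ _ → refl))
            (half-sum Q P (p + q) (p ∸ 1) (s (p ∸ 1)) N (s≤s⁻¹ 2≤p) (ℕ.+-comm p q) refl (λ _ → refl)))
          (seq-ζ (p + q) N (ℕ.≤-trans 2≤p (ℕ.m≤m+n p q)))))
      (truncated-identity P Q N)
  where
  open TruncatedIdentity
  open MainTerms
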